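{- For every $\epsilon>0$ there exists a constant $C>0$ such that the following holds. Let $d\in\mathbb{N}$ with $d\ge C$, let $G$ be a $d$-regular graph on $n$ vertices, and let $p\ge \frac{C}{d}$. Then, with probability tending to one as $n\to\infty$, the random subgraph $G_p$ contains a matching covering at least $(1-\epsilon)n$ vertices.
   Context: For a graph $G$ and $p\in[0,1]$, $G_p$ denotes the random subgraph of $G$ on the same vertex set obtained by retaining each edge of $G$ independently with probability $p$.
   Formalization: The edge probability p and the parameter ε (and the tolerance in "probability tending to one") range over rational numbers rather than real numbers. -}

module Defs where

open import Data.Bool using (Bool; true; false; _∧_; _∨_; not; if_then_else_)
open import Data.Nat using (ℕ; zero; suc; _<ᵇ_)
open import Data.Fin using (Fin; toℕ)
open import Data.Fin.Properties using () renaming (_≟_ to _≟F_)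
open import Data.List using (List; []; _∷_; length; filter; concatMap; map; _++_)
open import Data.Bool.ListAction using (any)
open import Data.List.Base using (allFin)
open import Data.Product using (_×_; _,_; proj₁; proj₂)
open import Data.Integer using (+_)
open import Data.Rational using (ℚ; _/_; _+_; _*_; _-_; 0ℚ; 1ℚ; _≤ᵇ_)
open import Relation.Nullary.Decidable using (⌊_⌋)
open import Relation.Binary.PropositionalEquality using (_≡_)

ℕ→ℚ : ℕ → ℚ
ℕ→ℚ n = + n / 1

record Graph (n : ℕ) : Set where
  field
    adj    : Fin n → Fin n → Bool
    sym    : ∀ i j → adj i j ≡ adj j i
    irrefl : ∀ i → adj i i ≡ false
open Graph public

degree : ∀ {n} → Graph n → Fin n → ℕ
degree G v = length (filter (λ j → adj G v j ≟B true) (allFin _))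
  where
  open import Data.Bool.Properties using () renaming (_≟_ to _≟B_)

IsRegular : ∀ {n} → Graph n → ℕ → Set
IsRegular G d = ∀ v → degree G v ≡ d

Edge : ℕ → Set
Edge n = Fin n × Fin n

edges : ∀ {n} → Graph n → List (Edge n)
edges {n} G =
  concatMap (λ i → concatMap (λ j →
      if (toℕ i <ᵇ toℕ j) ∧ adj G i j then (i , j) ∷ [] else []) (allFin n))
    (allFin n)

sublists : ∀ {A : Set} → List A → List (List A)
sublists [] = [] ∷ []
sublists (x ∷ xs) = let r = sublists xs in map (x ∷_) r ++ r

_∈ᵉ_ : ∀ {n} → Fin n → Edge n → Bool
v ∈ᵉ (a , b) = ⌊ v ≟F a ⌋ ∨ ⌊ v ≟F b ⌋

disjointᵉ : ∀ {n} → Edge n → Edge n → Bool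
disjointᵉ (a , b) e = not (a ∈ᵉ e) ∧ not (b ∈ᵉ e)

allB : ∀ {A : Set} → (A → Bool) → List A → Bool
allB p [] = true
allB p (x ∷ xs) = p x ∧ allB p xs

isMatching : ∀ {n} → List (Edge n) → Bool
isMatching [] = true
isMatching (e ∷ es) = allB (disjointᵉ e) es ∧ isMatching es

-- the edge set F (a subgraph of a graph on n vertices) contains a matching
-- covering at least (1 - ε) n vertices (a matching M covers 2|M| vertices)
hasLargeMatching : ∀ {n} → ℚ → List (Edge n) → Bool
hasLargeMatching {n} ε F =
  any (λ M → isMatching M ∧ ((1ℚ - ε) * ℕ→ℚ n ≤ᵇ ℕ→ℚ (2 Data.Nat.* length M)))
      (sublists F)

-- Probability, when each edge of `es` is retained independently with
-- probability p, that the property P holds of the set of retained edges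
-- (together with the already retained edges `acc`).
probAux : ∀ {A : Set} → ℚ → (List A → Bool) → List A → List A → ℚ
probAux p P [] acc = if P acc then 1ℚ else 0ℚ
probAux p P (e ∷ es) acc =
  p * probAux p P es (e ∷ acc) + (1ℚ - p) * probAux p P es acc

probLargeMatching : ∀ {n} → Graph n → ℚ → ℚ → ℚ
probLargeMatching G p ε = probAux p (hasLargeMatching ε) (edges G) []

{-# OPTIONS --safe #-}

-- By monotonicity in p we may take p d = C with C a large constant.  The matching number ν of G_p is
-- changed by at most one by inserting an edge, so by Efron–Stein its variance is at most p |E(G)| ≤ C n,
-- and by Chebyshev it suffices that 2 E ν ≥ (1 - ε/2) n.  For this, fix a 2-colouring of the vertices
-- for which nearly every vertex has about d/2 neighbours of the other colour, and keep only the
-- bichromatic edges.  In the resulting random bipartite graph the degrees x_v concentrate around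
-- μ = p d / 2.  For a vertex cover W, the degrees in W sum to at least those outside W, which forces
-- (n - 2|W|) μ ≤ Σ |x_v - μ|; by Kőnig's theorem the same holds with ν in place of |W|.
module Submission where

open import Defs hiding (sym)
open import Data.Nat using (ℕ; _≤_; _<_)
open import Data.Product using (Σ; _×_; ∃-syntax)
open import Data.Rational using (ℚ; 0ℚ; 1ℚ; _-_; _*_) renaming (_≤_ to _≤ℚ_; _<_ to _<ℚ_)

import Algebra.Properties.CommutativeMonoid.Sum
open import Data.Bool using (Bool; true; false; if_then_else_; _∧_; _∨_; not; _xor_) renaming (T to IsTrue)
open import Data.Bool.ListAction using (any)
import Data.Bool.Properties as Bool
open import Data.Empty using (⊥; ⊥-elim)
open import Data.Fin using (Fin; zero; suc; toℕ)
import Data.Fin.Properties as Fin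
import Data.Integer as ℤ
import Data.Integer.Properties as ℤ
open import Data.List using (List; []; _∷_; length; _++_; filter; map; concatMap; tabulate; allFin)
open import Data.Nat as ℕ using (zero; suc; z≤n; s≤s; _<ᵇ_)
import Data.Nat.Properties as ℕ
open import Data.List.Extrema ℕ.≤-totalOrder using (argmax; argmax-all; f[xs]≤f[argmax])
open import Data.List.Membership.Propositional using (_∈_)
open import Data.List.Membership.Propositional.Properties
  using (∈-map⁺; ∈-map⁻; ∈-++⁺ˡ; ∈-++⁺ʳ; ∈-++⁻; ∈-filter⁺; ∈-filter⁻)
open import Data.List.Relation.Binary.Sublist.Propositional
  using (_⊆_; []; _∷_; _∷ʳ_; ⊆-refl; ⊆-trans; minimum) renaming (lookup to ⊆-lookup)
open import Data.List.Relation.Binary.Sublist.Propositional.Properties using (filter-⊆)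
open import Data.List.Relation.Unary.All as All using (All)
open import Data.List.Relation.Unary.Any using (here; there)
open import Data.Product using (_,_; proj₁; proj₂)
open import Data.Rational using (_+_; -_; ½; toℚᵘ; nonNegative; positive)
import Data.Rational as ℚ
import Data.Rational.Properties as ℚ
open import Data.Rational.Solver using (module +-*-Solver)
import Data.Rational.Unnormalised as ℚᵘ
import Data.Rational.Unnormalised.Properties as ℚᵘ
open import Data.Sum using (_⊎_; inj₁; inj₂)
import Data.Vec.Functional as VF
open import Function using (_∘_; id)
open import Relation.Binary using (tri<; tri≈; tri>)
open import Relation.Binary.PropositionalEquality
open import Relation.Nullary using (¬_; Dec; yes; no; does)
open import Relation.Nullary.Decidable using (decidable-stable)
open +-*-Solver using (solve; _:=_; _:+_; _:*_; _:-_; :-_; con)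

-- Fixing p d = C keeps the variance bound p |E(G)| linear in n with a constant independent of d, so
-- that it is negligible against the scale n² of Chebyshev's inequality. The colouring is there
-- because a bound on all vertex covers passes to matchings only in the bipartite case: in general a
-- minimum cover can be twice as large as a maximum matching. Its price is half of the expected
-- degree, which C absorbs; being chosen before sampling, it leaves the edges independent. The sum
-- of absolute deviations is replaced through 2 s |y| ≤ y² + s² by second moments, which are
-- polynomial in p and need no square roots. With 1/K ≤ ε, C = 20 K², μ = 10 K² and s = 5 K, the
-- total error 50 K² n divided by 2 s μ = 100 K³ gives n - 2 E ν ≤ n / (2 K) ≤ ε n / 2. The other
-- half of ε pays for the fluctuation of ν around its mean.

private variable
  A B : Set
  n : ℕ

-- Rational arithmetic

infixl 8 _²
_² : ℚ → ℚ
x ² = x * x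

0≤+ : ∀ {x y} → 0ℚ ≤ℚ x → 0ℚ ≤ℚ y → 0ℚ ≤ℚ x + y
0≤+ p q = ℚ.+-mono-≤ p q

0≤* : ∀ {x y} → 0ℚ ≤ℚ x → 0ℚ ≤ℚ y → 0ℚ ≤ℚ x * y
0≤* {x} {y} p q = ℚ.nonNegative⁻¹ (x * y)
  {{ℚ.nonNeg*nonNeg⇒nonNeg x {{nonNegative p}} y {{nonNegative q}}}}

0≤² : ∀ x → 0ℚ ≤ℚ x ²
0≤² x with ℚ.≤-total 0ℚ x
... | inj₁ 0≤x = 0≤* 0≤x 0≤x
... | inj₂ x≤0 = subst (0ℚ ≤ℚ_) (solve 1 (λ a → (:- a) :* (:- a) := a :* a) refl x)
                   (0≤* (ℚ.neg-antimono-≤ x≤0) (ℚ.neg-antimono-≤ x≤0))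

0≤y-x : ∀ {x y} → x ≤ℚ y → 0ℚ ≤ℚ y - x
0≤y-x {x} {y} p = subst (_≤ℚ y - x) (ℚ.+-inverseʳ x) (ℚ.+-monoˡ-≤ (- x) p)

x≤x+y : ∀ {x y} → 0ℚ ≤ℚ y → x ≤ℚ x + y
x≤x+y {x} {y} p = subst (_≤ℚ x + y) (ℚ.+-identityʳ x) (ℚ.+-monoʳ-≤ x p)

≤-by : ∀ {x y} z → 0ℚ ≤ℚ z → y ≡ x + z → x ≤ℚ y
≤-by z 0≤z refl = x≤x+y 0≤z

*-monoʳ : ∀ {x y} z → 0ℚ ≤ℚ z → x ≤ℚ y → z * x ≤ℚ z * y
*-monoʳ z 0≤z = ℚ.*-monoˡ-≤-nonNeg z {{nonNegative 0≤z}}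

*-cancel : ∀ {x y} z → 0ℚ <ℚ z → z * x ≤ℚ z * y → x ≤ℚ y
*-cancel z 0<z = ℚ.*-cancelˡ-≤-pos z {{positive 0<z}}

ℕ→ℚ-suc : ∀ n → ℕ→ℚ (suc n) ≡ 1ℚ + ℕ→ℚ n
ℕ→ℚ-suc n = ℚ.toℚᵘ-injective (begin
  toℚᵘ (ℕ→ℚ (suc n))            ≈⟨ toℚᵘ-ℕ→ℚ (suc n) ⟩
  (ℤ.+ suc n) ℚᵘ./ 1              ≈⟨ ℚᵘ.*≡* (cong (λ z → (ℤ.1ℤ ℤ.+ z) ℤ.* ℤ.1ℤ) (sym (ℤ.*-identityʳ (ℤ.+ n)))) ⟩
  ℚᵘ.1ℚᵘ ℚᵘ.+ ((ℤ.+ n) ℚᵘ./ 1)    ≈⟨ ℚᵘ.+-congʳ ℚᵘ.1ℚᵘ (ℚᵘ.≃-sym (toℚᵘ-ℕ→ℚ n)) ⟩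
  ℚᵘ.1ℚᵘ ℚᵘ.+ toℚᵘ (ℕ→ℚ n)      ≈⟨ ℚᵘ.≃-sym (ℚ.toℚᵘ-homo-+ 1ℚ (ℕ→ℚ n)) ⟩
  toℚᵘ (1ℚ + ℕ→ℚ n)             ∎)
  where
  open ℚᵘ.≃-Reasoning
  toℚᵘ-ℕ→ℚ : ∀ m → toℚᵘ (ℕ→ℚ m) ℚᵘ.≃ ((ℤ.+ m) ℚᵘ./ 1)
  toℚᵘ-ℕ→ℚ m = ℚ.toℚᵘ-fromℚᵘ ((ℤ.+ m) ℚᵘ./ 1)

ℕ→ℚ-+ : ∀ m n → ℕ→ℚ (m ℕ.+ n) ≡ ℕ→ℚ m + ℕ→ℚ n
ℕ→ℚ-+ zero n = sym (ℚ.+-identityˡ _)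
ℕ→ℚ-+ (suc m) n = begin
  ℕ→ℚ (suc (m ℕ.+ n))         ≡⟨ ℕ→ℚ-suc (m ℕ.+ n) ⟩
  1ℚ + ℕ→ℚ (m ℕ.+ n)          ≡⟨ cong (1ℚ +_) (ℕ→ℚ-+ m n) ⟩
  1ℚ + (ℕ→ℚ m + ℕ→ℚ n)        ≡⟨ sym (ℚ.+-assoc 1ℚ (ℕ→ℚ m) (ℕ→ℚ n)) ⟩
  1ℚ + ℕ→ℚ m + ℕ→ℚ n          ≡⟨ cong (_+ ℕ→ℚ n) (sym (ℕ→ℚ-suc m)) ⟩
  ℕ→ℚ (suc m) + ℕ→ℚ n         ∎
  where open ≡-Reasoning

ℕ→ℚ-* : ∀ m n → ℕ→ℚ (m ℕ.* n) ≡ ℕ→ℚ m * ℕ→ℚ n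
ℕ→ℚ-* zero n = sym (ℚ.*-zeroˡ (ℕ→ℚ n))
ℕ→ℚ-* (suc m) n = begin
  ℕ→ℚ (n ℕ.+ m ℕ.* n)         ≡⟨ ℕ→ℚ-+ n (m ℕ.* n) ⟩
  ℕ→ℚ n + ℕ→ℚ (m ℕ.* n)       ≡⟨ cong (ℕ→ℚ n +_) (ℕ→ℚ-* m n) ⟩
  ℕ→ℚ n + ℕ→ℚ m * ℕ→ℚ n       ≡⟨ solve 2 (λ a b → b :+ a :* b := (con 1ℚ :+ a) :* b) refl (ℕ→ℚ m) (ℕ→ℚ n) ⟩
  (1ℚ + ℕ→ℚ m) * ℕ→ℚ n        ≡⟨ cong (_* ℕ→ℚ n) (sym (ℕ→ℚ-suc m)) ⟩
  ℕ→ℚ (suc m) * ℕ→ℚ n         ∎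
  where open ≡-Reasoning

0≤1 : 0ℚ ≤ℚ 1ℚ
0≤1 = ℚ.nonNegative⁻¹ 1ℚ

0≤ℕ→ℚ : ∀ n → 0ℚ ≤ℚ ℕ→ℚ n
0≤ℕ→ℚ zero = ℚ.≤-refl
0≤ℕ→ℚ (suc n) = subst (0ℚ ≤ℚ_) (sym (ℕ→ℚ-suc n)) (0≤+ 0≤1 (0≤ℕ→ℚ n))

0<ℕ→ℚ : ∀ {n} → 0 < n → 0ℚ <ℚ ℕ→ℚ n
0<ℕ→ℚ {suc n} _ = subst (0ℚ <ℚ_) (sym (ℕ→ℚ-suc n)) (ℚ.+-mono-<-≤ (ℚ.positive⁻¹ 1ℚ) (0≤ℕ→ℚ n))

ℕ→ℚ-mono : ∀ {m n} → m ≤ n → ℕ→ℚ m ≤ℚ ℕ→ℚ n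
ℕ→ℚ-mono {m} {n} m≤n = ≤-by (ℕ→ℚ (n ℕ.∸ m)) (0≤ℕ→ℚ (n ℕ.∸ m))
  (trans (cong ℕ→ℚ (sym (ℕ.m+[n∸m]≡n m≤n))) (ℕ→ℚ-+ m (n ℕ.∸ m)))

-- Expectation over random sublists

E : ℚ → (List A → ℚ) → List A → List A → ℚ
E p f []       acc = f acc
E p f (e ∷ es) acc = p * E p f es (e ∷ acc) + (1ℚ - p) * E p f es acc

⟦_⟧ : Bool → ℚ
⟦ b ⟧ = if b then 1ℚ else 0ℚ

probAux≡E : ∀ p (P : List A → Bool) es acc → probAux p P es acc ≡ E p (λ F → ⟦ P F ⟧) es acc
probAux≡E p P []       acc = refl
probAux≡E p P (e ∷ es) acc =
  cong₂ (λ x y → p * x + (1ℚ - p) * y) (probAux≡E p P es (e ∷ acc)) (probAux≡E p P es acc)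

-- Insertion is allowed at any position, not only at the head: `E` pushes the edges decided after
-- `e` in front of it, so an induction over them meets `e` deeper in the list.
InsertionMonotone InsertionLipschitz : (List A → ℚ) → Set
InsertionMonotone  f = ∀ xs e ys → f (xs ++ ys) ≤ℚ f (xs ++ e ∷ ys)
InsertionLipschitz f = ∀ xs e ys → f (xs ++ e ∷ ys) ≤ℚ f (xs ++ ys) + 1ℚ

sumˡ : (A → ℚ) → List A → ℚ
sumˡ a []       = 0ℚ
sumˡ a (x ∷ xs) = a x + sumˡ a xs

module Expectation {p : ℚ} (0≤p : 0ℚ ≤ℚ p) (p≤1 : p ≤ℚ 1ℚ) where

  0≤1-p : 0ℚ ≤ℚ 1ℚ - p
  0≤1-p = 0≤y-x p≤1

  mix-mono : ∀ {a a′ b b′} → a ≤ℚ a′ → b ≤ℚ b′ → p * a + (1ℚ - p) * b ≤ℚ p * a′ + (1ℚ - p) * b′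
  mix-mono a≤a′ b≤b′ = ℚ.+-mono-≤ (*-monoʳ p 0≤p a≤a′) (*-monoʳ (1ℚ - p) 0≤1-p b≤b′)

  E-mono : ∀ {f g : List A → ℚ} → (∀ F → f F ≤ℚ g F) → ∀ es acc → E p f es acc ≤ℚ E p g es acc
  E-mono f≤g []       acc = f≤g acc
  E-mono f≤g (e ∷ es) acc = mix-mono (E-mono f≤g es (e ∷ acc)) (E-mono f≤g es acc)

  E-insertion-mono : ∀ {f : List A → ℚ} → InsertionMonotone f → ∀ es → InsertionMonotone (E p f es)
  E-insertion-mono mono []       = mono
  E-insertion-mono mono (x ∷ es) xs e ys =
    mix-mono (E-insertion-mono mono es (x ∷ xs) e ys) (E-insertion-mono mono es xs e ys)

  E-insertion-Lipschitz : ∀ {f : List A → ℚ} → InsertionLipschitz f → ∀ es → InsertionLipschitz (E p f es)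
  E-insertion-Lipschitz lip [] = lip
  E-insertion-Lipschitz {f = f} lip (x ∷ es) xs e ys = subst (E p f (x ∷ es) (xs ++ e ∷ ys) ≤ℚ_)
    (solve 3 (λ p a b → p :* (a :+ con 1ℚ) :+ (con 1ℚ :- p) :* (b :+ con 1ℚ)
                     := p :* a :+ (con 1ℚ :- p) :* b :+ con 1ℚ) refl
       p (E p f es (x ∷ xs ++ ys)) (E p f es (xs ++ ys)))
    (mix-mono (E-insertion-Lipschitz lip es (x ∷ xs) e ys) (E-insertion-Lipschitz lip es xs e ys))

  -- Efron–Stein: each edge contributes at most p (1 - p) times the squared effect of its insertion.
  variance-bound : ∀ {f : List A → ℚ} → InsertionMonotone f → InsertionLipschitz f → ∀ z es acc →
    E p (λ F → (f F - z) ²) es acc ≤ℚ ℕ→ℚ (length es) * p + (E p f es acc - z) ²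
  variance-bound {f = f} mono lip z [] acc =
    ℚ.≤-reflexive (solve 2 (λ p y → y := con 0ℚ :* p :+ y) refl p ((f acc - z) ²))
  variance-bound {f = f} mono lip z (e ∷ es) acc = ℚ.≤-trans
    (mix-mono (variance-bound mono lip z es (e ∷ acc)) (variance-bound mono lip z es acc))
    -- The slack is p - p (1 - p) Δ², factored so that 0 ≤ Δ ≤ 1 makes its sign visible.
    (≤-by (p * (p + (1ℚ - p) * ((1ℚ - Δ) * (1ℚ + Δ))))
      (0≤* 0≤p (0≤+ 0≤p (0≤* 0≤1-p (0≤* 0≤1-Δ (0≤+ 0≤1 0≤Δ)))))
      (trans (cong (λ y → y * p + (p * m₁ + (1ℚ - p) * m₀ - z) ²) (ℕ→ℚ-suc (length es)))
        (solve 5 (λ p l a b z →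
            (con 1ℚ :+ l) :* p :+ (p :* a :+ (con 1ℚ :- p) :* b :- z) :* (p :* a :+ (con 1ℚ :- p) :* b :- z)
         := p :* (l :* p :+ (a :- z) :* (a :- z)) :+ (con 1ℚ :- p) :* (l :* p :+ (b :- z) :* (b :- z))
            :+ p :* (p :+ (con 1ℚ :- p) :* ((con 1ℚ :- (a :- b)) :* (con 1ℚ :+ (a :- b))))) refl
          p (ℕ→ℚ (length es)) m₁ m₀ z)))
    where
    m₁ m₀ Δ : ℚ
    m₁ = E p f es (e ∷ acc)
    m₀ = E p f es acc
    Δ = m₁ - m₀
    0≤Δ : 0ℚ ≤ℚ Δ
    0≤Δ = 0≤y-x (E-insertion-mono mono es [] e acc)
    0≤1-Δ : 0ℚ ≤ℚ 1ℚ - Δ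
    0≤1-Δ = subst (0ℚ ≤ℚ_) (solve 2 (λ a b → b :+ con 1ℚ :- a := con 1ℚ :- (a :- b)) refl m₁ m₀)
              (0≤y-x (E-insertion-Lipschitz lip es [] e acc))

-- Raising the probability of one edge moves weight `q - p` from the branch without it to the branch
-- with it, a gain of `(q - p) * (a - b)`. This edge-by-edge exchange takes the place of a coupling
-- of the two random subgraphs.
E-mono-p : ∀ {p q} → 0ℚ ≤ℚ p → p ≤ℚ q → q ≤ℚ 1ℚ → ∀ {f : List A → ℚ} → InsertionMonotone f →
  ∀ es acc → E p f es acc ≤ℚ E q f es acc
E-mono-p 0≤p p≤q q≤1 mono [] acc = ℚ.≤-refl
E-mono-p {p = p} {q} 0≤p p≤q q≤1 {f} mono (e ∷ es) acc = ℚ.≤-trans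
  (Expectation.mix-mono 0≤p (ℚ.≤-trans p≤q q≤1)
    (E-mono-p 0≤p p≤q q≤1 mono es (e ∷ acc)) (E-mono-p 0≤p p≤q q≤1 mono es acc))
  (≤-by ((q - p) * (a - b))
    (0≤* (0≤y-x p≤q) (0≤y-x (Expectation.E-insertion-mono (ℚ.≤-trans 0≤p p≤q) q≤1 mono es [] e acc)))
    (solve 4 (λ p q a b → q :* a :+ (con 1ℚ :- q) :* b
                       := p :* a :+ (con 1ℚ :- p) :* b :+ (q :- p) :* (a :- b)) refl p q a b))
  where
  a b : ℚ
  a = E q f es (e ∷ acc)
  b = E q f es acc

E-const : ∀ p k (es acc : List A) → E p (λ _ → k) es acc ≡ k
E-const p k []       acc = refl
E-const p k (e ∷ es) acc = trans
  (cong₂ (λ x y → p * x + (1ℚ - p) * y) (E-const p k es (e ∷ acc)) (E-const p k es acc))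
  (solve 2 (λ p k → p :* k :+ (con 1ℚ :- p) :* k := k) refl p k)

E-+ : ∀ p (f g : List A → ℚ) es acc → E p (λ F → f F + g F) es acc ≡ E p f es acc + E p g es acc
E-+ p f g []       acc = refl
E-+ p f g (e ∷ es) acc = trans
  (cong₂ (λ x y → p * x + (1ℚ - p) * y) (E-+ p f g es (e ∷ acc)) (E-+ p f g es acc))
  (solve 5 (λ p a b c d → p :* (a :+ b) :+ (con 1ℚ :- p) :* (c :+ d)
     := p :* a :+ (con 1ℚ :- p) :* c :+ (p :* b :+ (con 1ℚ :- p) :* d)) refl
     p (E p f es (e ∷ acc)) (E p g es (e ∷ acc)) (E p f es acc) (E p g es acc))

E-* : ∀ p k (f : List A → ℚ) es acc → E p (λ F → k * f F) es acc ≡ k * E p f es acc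
E-* p k f []       acc = refl
E-* p k f (e ∷ es) acc = trans
  (cong₂ (λ x y → p * x + (1ℚ - p) * y) (E-* p k f es (e ∷ acc)) (E-* p k f es acc))
  (solve 4 (λ p k a b → p :* (k :* a) :+ (con 1ℚ :- p) :* (k :* b)
     := k :* (p :* a :+ (con 1ℚ :- p) :* b)) refl p k (E p f es (e ∷ acc)) (E p f es acc))

-- Variance plus squared bias of a weighted sum of independent Bernoulli variables. The centre `z`
-- is free because the degrees are later compared with a common value that need not be their mean.
E-additive-² : ∀ p (a : A → ℚ) z es acc →
  E p (λ F → (sumˡ a F - z) ²) es acc
    ≡ p * (1ℚ - p) * sumˡ (λ e → a e ²) es + (sumˡ a acc + p * sumˡ a es - z) ²
E-additive-² p a z [] acc =
  solve 3 (λ p s z → (s :- z) :* (s :- z) := p :* (con 1ℚ :- p) :* con 0ℚ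
    :+ (s :+ p :* con 0ℚ :- z) :* (s :+ p :* con 0ℚ :- z)) refl p (sumˡ a acc) z
E-additive-² p a z (e ∷ es) acc = trans
  (cong₂ (λ x y → p * x + (1ℚ - p) * y) (E-additive-² p a z es (e ∷ acc)) (E-additive-² p a z es acc))
  (solve 6 (λ p a v s t z →
      p :* (p :* (con 1ℚ :- p) :* v :+ (a :+ s :+ p :* t :- z) :* (a :+ s :+ p :* t :- z))
      :+ (con 1ℚ :- p) :* (p :* (con 1ℚ :- p) :* v :+ (s :+ p :* t :- z) :* (s :+ p :* t :- z))
   := p :* (con 1ℚ :- p) :* (a :* a :+ v)
      :+ (s :+ p :* (a :+ t) :- z) :* (s :+ p :* (a :+ t) :- z)) refl
   p (a e) (sumˡ (λ e → a e ²) es) (sumˡ a acc) (sumˡ a es) z)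

E-cong : ∀ p {f g : List A → ℚ} → (∀ F → f F ≡ g F) → ∀ es acc → E p f es acc ≡ E p g es acc
E-cong p f≡g []       acc = f≡g acc
E-cong p f≡g (e ∷ es) acc =
  cong₂ (λ x y → p * x + (1ℚ - p) * y) (E-cong p f≡g es (e ∷ acc)) (E-cong p f≡g es acc)

-- Matchings and vertex covers

module ℕΣ = Algebra.Properties.CommutativeMonoid.Sum ℕ.+-0-commutativeMonoid

∈-sublists⁺ : {xs ys : List A} → xs ⊆ ys → xs ∈ sublists ys
∈-sublists⁺ []                        = here refl
∈-sublists⁺ {ys = y ∷ ys} (.y ∷ʳ s)   = ∈-++⁺ʳ (map (y ∷_) (sublists ys)) (∈-sublists⁺ s)
∈-sublists⁺ {ys = y ∷ ys} (refl ∷ s)  = ∈-++⁺ˡ (∈-map⁺ (y ∷_) (∈-sublists⁺ s))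

∈-sublists⁻ : (xs ys : List A) → xs ∈ sublists ys → xs ⊆ ys
∈-sublists⁻ xs [] (here refl) = []
∈-sublists⁻ xs (y ∷ ys) m with ∈-++⁻ (map (y ∷_) (sublists ys)) m
... | inj₂ m′ = y ∷ʳ ∈-sublists⁻ xs ys m′
... | inj₁ m′ with ∈-map⁻ (y ∷_) m′
...   | xs′ , m″ , refl = refl ∷ ∈-sublists⁻ xs′ ys m″

data Remove (e : A) : List A → List A → Set where
  here  : ∀ {xs} → Remove e (e ∷ xs) xs
  there : ∀ {x xs ys} → Remove e xs ys → Remove e (x ∷ xs) (x ∷ ys)

Remove-++ : ∀ (xs : List A) e ys → Remove e (xs ++ e ∷ ys) (xs ++ ys)
Remove-++ []       e ys = here
Remove-++ (x ∷ xs) e ys = there (Remove-++ xs e ys)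

Remove⇒⊆ : ∀ {e : A} {xs ys} → Remove e xs ys → ys ⊆ xs
Remove⇒⊆ (here {xs})  = _ ∷ʳ ⊆-refl
Remove⇒⊆ (there r)    = refl ∷ Remove⇒⊆ r

Remove⇒length : ∀ {e : A} {xs ys} → Remove e xs ys → length xs ≡ suc (length ys)
Remove⇒length here      = refl
Remove⇒length (there r) = cong suc (Remove⇒length r)

Remove⇒∈ : ∀ {e : A} {xs ys} → Remove e xs ys → ∀ {f} → f ∈ xs → f ≡ e ⊎ f ∈ ys
Remove⇒∈ here      (here eq)  = inj₁ eq
Remove⇒∈ here      (there m)  = inj₂ m
Remove⇒∈ (there r) (here eq)  = inj₂ (here eq)
Remove⇒∈ (there r) (there m) with Remove⇒∈ r m
... | inj₁ eq = inj₁ eq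
... | inj₂ m′ = inj₂ (there m′)

⊆-Remove : ∀ {e : A} {xs ys zs} → zs ⊆ xs → Remove e xs ys →
  ∃[ ws ] (ws ⊆ ys × ws ⊆ zs × length zs ≤ suc (length ws))
⊆-Remove (_ ∷ʳ s)   here      = _ , s , ⊆-refl , ℕ.n≤1+n _
⊆-Remove (refl ∷ s) here      = _ , s , _ ∷ʳ ⊆-refl , ℕ.≤-refl
⊆-Remove (y ∷ʳ s)   (there r) with ⊆-Remove s r
... | ws , s₁ , s₂ , l = ws , y ∷ʳ s₁ , s₂ , l
⊆-Remove (refl ∷ s) (there r) with ⊆-Remove s r
... | ws , s₁ , s₂ , l = _ ∷ ws , refl ∷ s₁ , refl ∷ s₂ , s≤s l

∧-true : ∀ {a b} → a ∧ b ≡ true → a ≡ true × b ≡ true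
∧-true {true} {true} _ = refl , refl

allB-⊆ : ∀ (p : A → Bool) {xs ys} → xs ⊆ ys → allB p ys ≡ true → allB p xs ≡ true
allB-⊆ p []         _ = refl
allB-⊆ p (y ∷ʳ s)   h = allB-⊆ p s (proj₂ (∧-true {p y} h))
allB-⊆ p (_∷_ {y} refl s) h = cong₂ _∧_ (proj₁ (∧-true {p y} h)) (allB-⊆ p s (proj₂ (∧-true {p y} h)))

isMatching-⊆ : {M N : List (Edge n)} → M ⊆ N → isMatching N ≡ true → isMatching M ≡ true
isMatching-⊆ []               _ = refl
isMatching-⊆ {N = y ∷ N} (.y ∷ʳ s) h = isMatching-⊆ s (proj₂ (∧-true {allB (disjointᵉ y) N} h))
isMatching-⊆ {N = y ∷ N} (refl ∷ s) h = cong₂ _∧_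
  (allB-⊆ (disjointᵉ y) s (proj₁ (∧-true {allB (disjointᵉ y) N} h)))
  (isMatching-⊆ s (proj₂ (∧-true {allB (disjointᵉ y) N} h)))

matchings : List (Edge n) → List (List (Edge n))
matchings F = filter (λ M → isMatching M Bool.≟ true) (sublists F)

opaque
  -- The default `[]` of `argmax` is itself a matching inside `F`, so it does not distort the
  -- maximum.
  ν : List (Edge n) → ℕ
  ν F = length (argmax length [] (matchings F))

  ν-attained : (F : List (Edge n)) → ∃[ M ] (isMatching M ≡ true × M ⊆ F × length M ≡ ν F)
  ν-attained F =
    let (h , s) = argmax-all length {P = λ M → isMatching M ≡ true × M ⊆ F} (refl , minimum F)
          (All.tabulate λ m → let (m′ , h) = ∈-filter⁻ (λ M → isMatching M Bool.≟ true) m in h , ∈-sublists⁻ _ F m′)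
    in _ , h , s , refl

  length≤ν : {M F : List (Edge n)} → isMatching M ≡ true → M ⊆ F → length M ≤ ν F
  length≤ν {F = F} h s = All.lookup (f[xs]≤f[argmax] {f = length} [] (matchings F))
    (∈-filter⁺ (λ M → isMatching M Bool.≟ true) (∈-sublists⁺ s) h)

ν-⊆ : {F F′ : List (Edge n)} → F ⊆ F′ → ν F ≤ ν F′
ν-⊆ {F = F} {F′} s = let (M , h , s′ , l) = ν-attained F in
  subst (_≤ ν F′) l (length≤ν h (⊆-trans s′ s))

-- Restricting a maximum matching of `F` to `F′` loses at most the one removed edge.
ν-Remove : ∀ {e} {F F′ : List (Edge n)} → Remove e F F′ → ν F ≤ suc (ν F′)
ν-Remove {F = F} {F′} r =
  let (M , h , s , l) = ν-attained F
      (M′ , s₁ , s₂ , l′) = ⊆-Remove s r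
  in subst (_≤ suc (ν F′)) l (ℕ.≤-trans l′ (s≤s (length≤ν (isMatching-⊆ s₂ h) s₁)))

Endpoint : Fin n → Edge n → Set
Endpoint v (a , b) = v ≡ a ⊎ v ≡ b

Bichromatic : (Fin n → Bool) → Edge n → Set
Bichromatic c (a , b) = c a xor c b ≡ true

Covered : (Fin n → Bool) → Edge n → Set
Covered W e = ∃[ v ] (Endpoint v e × W v ≡ true)

Cover : (Fin n → Bool) → List (Edge n) → Set
Cover W F = ∀ {e} → e ∈ F → Covered W e

bit : Bool → ℕ
bit b = if b then 1 else 0

count : (Fin n → Bool) → ℕ
count W = ℕΣ.sum (bit ∘ W)

bit-∨ : ∀ a b → bit (a ∨ b) ≤ bit a ℕ.+ bit b
bit-∨ true  b = s≤s z≤n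
bit-∨ false b = ℕ.≤-refl

sum-mono : (f g : Fin n → ℕ) → (∀ i → f i ≤ g i) → ℕΣ.sum f ≤ ℕΣ.sum g
sum-mono {zero}  f g f≤g = z≤n
sum-mono {suc n} f g f≤g = ℕ.+-mono-≤ (f≤g zero) (sum-mono (f ∘ suc) (g ∘ suc) (f≤g ∘ suc))

count-single : (u : Fin n) → count (λ v → does (u Fin.≟ v)) ≡ 1
count-single {suc n} zero    = cong suc (ℕΣ.sum-replicate-zero n)
count-single {suc n} (suc u) = count-single u

count-insert : (W : Fin n → Bool) (u : Fin n) → count (λ v → does (u Fin.≟ v) ∨ W v) ≤ suc (count W)
count-insert W u = begin
  count (λ v → does (u Fin.≟ v) ∨ W v)             ≤⟨ sum-mono _ _ (λ v → bit-∨ (does (u Fin.≟ v)) (W v)) ⟩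
  ℕΣ.sum (λ v → bit (does (u Fin.≟ v)) ℕ.+ bit (W v)) ≡⟨ ℕΣ.∑-distrib-+ (λ v → bit (does (u Fin.≟ v))) (bit ∘ W) ⟩
  count (λ v → does (u Fin.≟ v)) ℕ.+ count W       ≡⟨ cong (ℕ._+ count W) (count-single u) ⟩
  suc (count W)                                    ∎
  where open ℕ.≤-Reasoning

does-refl : (u : Fin n) → does (u Fin.≟ u) ≡ true
does-refl u with u Fin.≟ u
... | yes _  = refl
... | no u≢u = ⊥-elim (u≢u refl)

insert-⊇ : ∀ {W : Fin n → Bool} {u v} → W v ≡ true → does (u Fin.≟ v) ∨ W v ≡ true
insert-⊇ {u = u} {v} h = trans (cong (does (u Fin.≟ v) ∨_) h) (Bool.∨-zeroʳ _)

cover-by-length : (F : List (Edge n)) → ∃[ W ] (Cover W F × count W ≤ length F)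
cover-by-length {n} [] = (λ _ → false) , (λ ()) , ℕ.≤-reflexive (ℕΣ.sum-replicate-zero n)
cover-by-length {n} ((a , b) ∷ F) with cover-by-length F
... | W , cov , l = (λ v → does (a Fin.≟ v) ∨ W v) , cov′ , ℕ.≤-trans (count-insert W a) (s≤s l)
  where
  cov′ : Cover (λ v → does (a Fin.≟ v) ∨ W v) ((a , b) ∷ F)
  cov′ (here refl) = a , inj₁ refl , cong (_∨ W a) (does-refl a)
  cov′ (there m) = let (v , v∈e , h) = cov m in v , v∈e , insert-⊇ {W = W} {a} h

∈ᵉ⇒Endpoint : ∀ (v : Fin n) e → v ∈ᵉ e ≡ true → Endpoint v e
∈ᵉ⇒Endpoint v (a , b) h with v Fin.≟ a | v Fin.≟ b
... | yes v≡a | _       = inj₁ v≡a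
... | no _    | yes v≡b = inj₂ v≡b
∈ᵉ⇒Endpoint v (a , b) () | no _ | no _

shared-endpoint : ∀ (e e′ : Edge n) → disjointᵉ e e′ ≡ false → ∃[ u ] (Endpoint u e × Endpoint u e′)
shared-endpoint (a , b) e′ h with a ∈ᵉ e′ in eqa | b ∈ᵉ e′ in eqb
... | true  | _     = a , inj₁ refl , ∈ᵉ⇒Endpoint a e′ eqa
... | false | true  = b , inj₂ refl , ∈ᵉ⇒Endpoint b e′ eqb
shared-endpoint (a , b) e′ () | false | false

-- Kőnig's theorem by exchange of covers

record Conflict (F : List (Edge n)) : Set where
  field
    e₁ e₂ : Edge n
    F₁ F₂ : List (Edge n)
    remove₁ : Remove e₁ F F₁
    remove₂ : Remove e₂ F F₂
    -- These two fields make `e₁` and `e₂` different occurrences in the list, even if they happen to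
    -- be equal as edges.
    e₂∈F₁ : e₂ ∈ F₁
    e₁∈F₂ : e₁ ∈ F₂
    u : Fin n
    u∈e₁ : Endpoint u e₁
    u∈e₂ : Endpoint u e₂

allB-false : ∀ (p : A → Bool) xs → allB p xs ≡ false → ∃[ x ] ∃[ ys ] (Remove x xs ys × x ∈ xs × p x ≡ false)
allB-false p (x ∷ xs) h with p x in eq
... | false = x , xs , here , here refl , eq
... | true with allB-false p xs h
...   | y , ys , r , m , h′ = y , x ∷ ys , there r , there m , h′

conflict : (F : List (Edge n)) → isMatching F ≡ false → Conflict F
conflict (e ∷ F) h with allB (disjointᵉ e) F in eq
... | false = let (e′ , F′ , r , m , h′) = allB-false (disjointᵉ e) F eq
                  (u , u∈e , u∈e′) = shared-endpoint e e′ h′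
              in record { remove₁ = here ; remove₂ = there r ; e₂∈F₁ = m ; e₁∈F₂ = here refl
                        ; u = u ; u∈e₁ = u∈e ; u∈e₂ = u∈e′ }
... | true  = let open Conflict (conflict F h) in
              record { remove₁ = there remove₁ ; remove₂ = there remove₂ ; e₂∈F₁ = there e₂∈F₁
                     ; e₁∈F₂ = there e₁∈F₂ ; u = u ; u∈e₁ = u∈e₁ ; u∈e₂ = u∈e₂ }

monochromatic-endpoints : ∀ {c : Fin n → Bool} {e v w} → Bichromatic c e →
  Endpoint v e → Endpoint w e → c v ≡ c w → v ≡ w
monochromatic-endpoints bi (inj₁ refl) (inj₁ refl) _ = refl
monochromatic-endpoints bi (inj₂ refl) (inj₂ refl) _ = refl
monochromatic-endpoints {c = c} {a , b} bi (inj₁ refl) (inj₂ refl) eq with c a | c b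
monochromatic-endpoints () (inj₁ refl) (inj₂ refl) refl | true  | _
monochromatic-endpoints () (inj₁ refl) (inj₂ refl) refl | false | _
monochromatic-endpoints {c = c} {a , b} bi (inj₂ refl) (inj₁ refl) eq with c a | c b
monochromatic-endpoints () (inj₂ refl) (inj₁ refl) refl | true  | _
monochromatic-endpoints () (inj₂ refl) (inj₁ refl) refl | false | _

-- With `s` testing the colour of a vertex, this is the union of two vertex sets on one colour class
-- and their intersection on the other.
mix : Bool → Bool → Bool → Bool
mix s x y = if s then x ∨ y else x ∧ y

mix-both : ∀ s {x y} → x ≡ true → y ≡ true → mix s x y ≡ true
mix-both true  refl refl = refl
mix-both false refl refl = refl

mix-left : ∀ {s x y} → s ≡ true → x ≡ true → mix s x y ≡ true
mix-left refl refl = refl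

mix-right : ∀ {s x y} → s ≡ true → y ≡ true → mix s x y ≡ true
mix-right {x = x} refl refl = Bool.∨-zeroʳ x

-- The pointwise form of |X ∪ Y| + |X ∩ Y| = |X| + |Y|, with `b` marking the single vertex that is
-- added to one of the two mixed sets.
bit-mix : ∀ b s x y → bit (b ∨ mix s x y) ℕ.+ bit (mix (not s) x y) ≤ bit b ℕ.+ (bit x ℕ.+ bit y)
bit-mix b s x y = ℕ.≤-trans (ℕ.+-monoˡ-≤ _ (bit-∨ b (mix s x y)))
  (ℕ.≤-reflexive (trans (ℕ.+-assoc (bit b) _ _) (cong (bit b ℕ.+_) (modular s x y))))
  where
  modular : ∀ s x y → bit (mix s x y) ℕ.+ bit (mix (not s) x y) ≡ bit x ℕ.+ bit y
  modular true  true  true  = refl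
  modular true  true  false = refl
  modular true  false true  = refl
  modular true  false false = refl
  modular false true  true  = refl
  modular false true  false = refl
  modular false false true  = refl
  modular false false false = refl

-- Each cover provides an endpoint of `e`. If one of them lies in the class where the union is
-- taken, it survives. Otherwise both lie in the other class, hence coincide because `e` is
-- bichromatic, and the intersection contains them.
Covered-mix : ∀ {c : Fin n → Bool} {e W₁ W₂} x → Bichromatic c e → Covered W₁ e → Covered W₂ e →
  Covered (λ v → mix (c v xor x) (W₁ v) (W₂ v)) e
Covered-mix {c = c} {e} {W₁} {W₂} x bi (v , v∈e , h₁) (w , w∈e , h₂) with c v xor x in eq₁ | c w xor x in eq₂
... | true  | _     = v , v∈e , mix-left {c v xor x} {W₁ v} eq₁ h₁
... | false | true  = w , w∈e , mix-right {c w xor x} {W₁ w} eq₂ h₂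
... | false | false with monochromatic-endpoints bi v∈e w∈e (xor-cancel (c v) (c w) x eq₁ eq₂)
  where
  xor-cancel : ∀ a b x → a xor x ≡ false → b xor x ≡ false → a ≡ b
  xor-cancel true  true  true  _ _ = refl
  xor-cancel false false false _ _ = refl
  xor-cancel true  false true  _ ()
  xor-cancel false true  false _ ()
...   | refl = v , v∈e , mix-both (c v xor x) h₁ h₂

module _ {c : Fin n → Bool} where

  -- Lovász's exchange argument: combining covers W₁ of F ∖ e₁ and W₂ of F ∖ e₂ by colour class gives
  -- two covers of F whose sizes add up to at most |W₁| + |W₂| + 1.
  exchange : ∀ {F} → (∀ {e} → e ∈ F → Bichromatic c e) → (clash : Conflict F) → let open Conflict clash in
    ∀ {W₁ W₂} → Cover W₁ F₁ → Cover W₂ F₂ →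
    Cover W₁ F ⊎ Cover W₂ F ⊎
    ∃[ K₁ ] ∃[ K₂ ] (Cover K₁ F × Cover K₂ F × count K₁ ℕ.+ count K₂ ≤ suc (count W₁ ℕ.+ count W₂))
  exchange {F} bi clash {W₁} {W₂} cov₁ cov₂ with W₁ (Conflict.u clash) in h₁ | W₂ (Conflict.u clash) in h₂
  -- A cover containing the shared endpoint `u` also covers the removed edge, so it is already a
  -- cover of `F`.
  ... | true | _ = inj₁ λ m → cover (Remove⇒∈ remove₁ m)
    where
    open Conflict clash
    cover : ∀ {f} → f ≡ e₁ ⊎ f ∈ F₁ → Covered W₁ f
    cover (inj₁ refl) = u , u∈e₁ , h₁
    cover (inj₂ m)    = cov₁ m
  ... | false | true = inj₂ (inj₁ λ m → cover (Remove⇒∈ remove₂ m))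
    where
    open Conflict clash
    cover : ∀ {f} → f ≡ e₂ ⊎ f ∈ F₂ → Covered W₂ f
    cover (inj₁ refl) = u , u∈e₂ , h₂
    cover (inj₂ m)    = cov₂ m
  ... | false | false = inj₂ (inj₂ (K₁ , K₂ , cov-K₁ , cov-K₂ , size))
    where
    open Conflict clash
    K₁ K₂ : Fin n → Bool
    -- `K₁` takes the union on the colour class of `u` and the intersection on the other, `K₂` the
    -- reverse. Adding `u` to `K₁` covers both clashing edges and accounts for the extra 1 in the
    -- total size.
    K₁ v = does (u Fin.≟ v) ∨ mix (c v xor not (c u)) (W₁ v) (W₂ v)
    K₂ v = mix (c v xor c u) (W₁ v) (W₂ v)

    cover-cases : ∀ {K} → Covered K e₁ → Covered K e₂ →
      (∀ {f} → f ∈ F → Covered W₁ f → Covered W₂ f → Covered K f) → Cover K F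
    cover-cases k₁ k₂ k m with Remove⇒∈ remove₁ m | Remove⇒∈ remove₂ m
    ... | inj₁ refl | _         = k₁
    ... | inj₂ _    | inj₁ refl = k₂
    ... | inj₂ m₁   | inj₂ m₂   = k m (cov₁ m₁) (cov₂ m₂)

    K₁-u : K₁ u ≡ true
    K₁-u = cong (_∨ mix (c u xor not (c u)) (W₁ u) (W₂ u)) (does-refl u)

    cov-K₁ : Cover K₁ F
    cov-K₁ = cover-cases (u , u∈e₁ , K₁-u) (u , u∈e₂ , K₁-u) λ {f} m k₁ k₂ →
      let (v , v∈f , h) = Covered-mix {c = c} {f} (not (c u)) (bi m) k₁ k₂
      in v , v∈f , trans (cong (does (u Fin.≟ v) ∨_) h) (Bool.∨-zeroʳ _)

    -- `W₂` still covers `e₁`, and `W₁` still covers `e₂`. Neither contains `u`, so each does so at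
    -- the other endpoint, which lies in the class where `K₂` takes the union.
    opposite : ∀ {e v} {W : Fin n → Bool} → Bichromatic c e → Endpoint u e → Endpoint v e →
      W u ≡ false → W v ≡ true → c v xor c u ≡ true
    opposite {e} {v} bie u∈e v∈e Wu Wv with c v xor c u in eq
    ... | true  = refl
    ... | false with monochromatic-endpoints {c = c} {e} bie v∈e u∈e (xor-false (c v) (c u) eq)
      where
      xor-false : ∀ a b → a xor b ≡ false → a ≡ b
      xor-false true  true  _ = refl
      xor-false false false _ = refl
    ...   | refl with trans (sym Wu) Wv
    ...     | ()

    e₁∈F : e₁ ∈ F
    e₁∈F = ⊆-lookup (Remove⇒⊆ remove₂) e₁∈F₂
    e₂∈F : e₂ ∈ F
    e₂∈F = ⊆-lookup (Remove⇒⊆ remove₁) e₂∈F₁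

    cov-K₂ : Cover K₂ F
    cov-K₂ = cover-cases
      (let (v , v∈e , h) = cov₂ e₁∈F₂
       in v , v∈e , mix-right {c v xor c u} {W₁ v} (opposite {W = W₂} (bi e₁∈F) u∈e₁ v∈e h₂ h) h)
      (let (v , v∈e , h) = cov₁ e₂∈F₁
       in v , v∈e , mix-left {c v xor c u} {W₁ v} (opposite {W = W₁} (bi e₂∈F) u∈e₂ v∈e h₁ h) h)
      λ {f} m → Covered-mix {c = c} {f} (c u) (bi m)

    size : count K₁ ℕ.+ count K₂ ≤ suc (count W₁ ℕ.+ count W₂)
    size = begin
      count K₁ ℕ.+ count K₂
        ≡⟨ ℕΣ.∑-distrib-+ (bit ∘ K₁) (bit ∘ K₂) ⟨
      ℕΣ.sum (λ v → bit (K₁ v) ℕ.+ bit (K₂ v))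
        ≤⟨ sum-mono _ _ (λ v → subst
             (λ s → bit (K₁ v) ℕ.+ bit (mix s (W₁ v) (W₂ v)) ≤ bit (does (u Fin.≟ v)) ℕ.+ (bit (W₁ v) ℕ.+ bit (W₂ v)))
             (not-xor-not (c v) (c u))
             (bit-mix (does (u Fin.≟ v)) (c v xor not (c u)) (W₁ v) (W₂ v))) ⟩
      ℕΣ.sum (λ v → bit (does (u Fin.≟ v)) ℕ.+ (bit (W₁ v) ℕ.+ bit (W₂ v)))
        ≡⟨ ℕΣ.∑-distrib-+ (λ v → bit (does (u Fin.≟ v))) (λ v → bit (W₁ v) ℕ.+ bit (W₂ v)) ⟩
      count (λ v → does (u Fin.≟ v)) ℕ.+ ℕΣ.sum (λ v → bit (W₁ v) ℕ.+ bit (W₂ v))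
        ≡⟨ cong₂ ℕ._+_ (count-single u) (ℕΣ.∑-distrib-+ (bit ∘ W₁) (bit ∘ W₂)) ⟩
      suc (count W₁ ℕ.+ count W₂) ∎
      where
      open ℕ.≤-Reasoning
      not-xor-not : ∀ a b → not (a xor not b) ≡ a xor b
      not-xor-not true  true  = refl
      not-xor-not true  false = refl
      not-xor-not false true  = refl
      not-xor-not false false = refl

  -- Double negation spares a search through all vertex sets for the covers.
  kőnig : ∀ m (F : List (Edge n)) → length F ≤ m → (∀ {e} → e ∈ F → Bichromatic c e) →
    ¬ ¬ (∃[ W ] (Cover W F × count W ≤ ν F))
  kőnig m F l bi none with isMatching F in eq
  -- A matching is covered by one endpoint of each of its edges and is contained in itself, so its
  -- length is at most `ν F`.
  ... | true  = let (W , cov , s) = cover-by-length F in none (W , cov , ℕ.≤-trans s (length≤ν {M = F} {F} eq ⊆-refl))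
  ... | false with m | conflict F eq
  ...   | zero  | clash with () ← ℕ.≤-trans (ℕ.≤-reflexive (sym (Remove⇒length (Conflict.remove₁ clash)))) l
  ...   | suc m | clash =
    kőnig m F₁ (shorter remove₁) (λ e∈ → bi (⊆-lookup (Remove⇒⊆ remove₁) e∈)) λ (W₁ , cov₁ , s₁) →
    kőnig m F₂ (shorter remove₂) (λ e∈ → bi (⊆-lookup (Remove⇒⊆ remove₂) e∈)) λ (W₂ , cov₂ , s₂) →
    let s₁′ = ℕ.≤-trans s₁ (ν-⊆ (Remove⇒⊆ remove₁))
        s₂′ = ℕ.≤-trans s₂ (ν-⊆ (Remove⇒⊆ remove₂))
    in finish s₁′ s₂′ (exchange bi clash cov₁ cov₂)
    where
    open Conflict clash
    shorter : ∀ {e F′} → Remove e F F′ → length F′ ≤ m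
    shorter r = ℕ.≤-pred (ℕ.≤-trans (ℕ.≤-reflexive (sym (Remove⇒length r))) l)

    large : ∀ {W} → Cover W F → suc (ν F) ≤ count W
    large {W} cov = ℕ.≰⇒> λ s → none (W , cov , s)

    finish : ∀ {W₁ W₂} → count W₁ ≤ ν F → count W₂ ≤ ν F →
      Cover W₁ F ⊎ Cover W₂ F ⊎
      ∃[ K₁ ] ∃[ K₂ ] (Cover K₁ F × Cover K₂ F × count K₁ ℕ.+ count K₂ ≤ suc (count W₁ ℕ.+ count W₂)) → ⊥
    finish s₁ s₂ (inj₁ cov)        = none (_ , cov , s₁)
    finish s₁ s₂ (inj₂ (inj₁ cov)) = none (_ , cov , s₂)
    -- If no cover has size at most `ν F`, then `K₁` and `K₂` have total size at least 2 `ν F` + 2,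
    -- one more than the exchange permits.
    finish {W₁} {W₂} s₁ s₂ (inj₂ (inj₂ (K₁ , K₂ , c₁ , c₂ , s))) = ℕ.<-irrefl refl (begin-strict
      suc (ν F ℕ.+ ν F)            <⟨ ℕ.≤-reflexive (cong suc (sym (ℕ.+-suc (ν F) (ν F)))) ⟩
      suc (ν F) ℕ.+ suc (ν F)      ≤⟨ ℕ.+-mono-≤ (large c₁) (large c₂) ⟩
      count K₁ ℕ.+ count K₂        ≤⟨ s ⟩
      suc (count W₁ ℕ.+ count W₂)  ≤⟨ s≤s (ℕ.+-mono-≤ s₁ s₂) ⟩
      suc (ν F ℕ.+ ν F)            ∎)
      where open ℕ.≤-Reasoning

-- Sums over vertices and edges

module ℚΣ = Algebra.Properties.CommutativeMonoid.Sum ℚ.+-0-commutativeMonoid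
open ℚΣ using (sum)

sum-≤ : {f g : Fin n → ℚ} → (∀ i → f i ≤ℚ g i) → sum f ≤ℚ sum g
sum-≤ {zero}  f≤g = ℚ.≤-refl
sum-≤ {suc n} f≤g = ℚ.+-mono-≤ (f≤g zero) (sum-≤ (f≤g ∘ suc))

sum-cong : {f g : Fin n → ℚ} → (∀ i → f i ≡ g i) → sum f ≡ sum g
sum-cong = ℚΣ.sum-cong-≗

sum-+ : (f g : Fin n → ℚ) → sum (λ i → f i + g i) ≡ sum f + sum g
sum-+ = ℚΣ.∑-distrib-+

sum-* : ∀ k (f : Fin n → ℚ) → sum (λ i → k * f i) ≡ k * sum f
sum-* {zero}  k f = sym (ℚ.*-zeroʳ k)
sum-* {suc n} k f = trans (cong (k * f zero +_) (sum-* k (f ∘ suc)))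
  (sym (ℚ.*-distribˡ-+ k (f zero) (sum (f ∘ suc))))

sum-const : ∀ n k → sum {n} (λ _ → k) ≡ ℕ→ℚ n * k
sum-const zero    k = sym (ℚ.*-zeroˡ k)
sum-const (suc n) k = trans (cong (k +_) (sum-const n k))
  (trans (solve 2 (λ l k → k :+ l :* k := (con 1ℚ :+ l) :* k) refl (ℕ→ℚ n) k)
         (cong (_* k) (sym (ℕ→ℚ-suc n))))

-- The Kronecker delta.
κ : Fin n → Fin n → ℚ
κ v i = ⟦ does (v Fin.≟ i) ⟧

sum-κ : ∀ (v : Fin n) (g : Fin n → ℚ) → sum (λ i → κ v i * g i) ≡ g v
sum-κ {suc n} zero g = begin
  1ℚ * g zero + sum (λ i → 0ℚ * g (suc i)) ≡⟨ cong (1ℚ * g zero +_) (sum-* 0ℚ (g ∘ suc)) ⟩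
  1ℚ * g zero + 0ℚ * sum (g ∘ suc)         ≡⟨ solve 2 (λ x y → con 1ℚ :* x :+ con 0ℚ :* y := x) refl (g zero) (sum (g ∘ suc)) ⟩
  g zero                                   ∎
  where open ≡-Reasoning
sum-κ {suc n} (suc v) g = trans
  (cong (0ℚ * g zero +_) (sum-κ v (g ∘ suc)))
  (solve 2 (λ x y → con 0ℚ :* x :+ y := y) refl (g zero) (g (suc v)))

sumˡ-++ : ∀ (g : A → ℚ) xs ys → sumˡ g (xs ++ ys) ≡ sumˡ g xs + sumˡ g ys
sumˡ-++ g []       ys = sym (ℚ.+-identityˡ _)
sumˡ-++ g (x ∷ xs) ys = trans (cong (g x +_) (sumˡ-++ g xs ys)) (sym (ℚ.+-assoc (g x) (sumˡ g xs) (sumˡ g ys)))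

sumˡ-concatMap : ∀ (g : B → ℚ) (f : A → List B) (h : Fin n → A) →
  sumˡ g (concatMap f (tabulate h)) ≡ sum (λ i → sumˡ g (f (h i)))
sumˡ-concatMap {n = zero}  g f h = refl
sumˡ-concatMap {n = suc n} g f h = trans (sumˡ-++ g (f (h zero)) (concatMap f (tabulate (h ∘ suc))))
  (cong (sumˡ g (f (h zero)) +_) (sumˡ-concatMap g f (h ∘ suc)))

sumˡ-if : ∀ (g : A → ℚ) b x → sumˡ g (if b then x ∷ [] else []) ≡ ⟦ b ⟧ * g x
sumˡ-if g true  x = solve 1 (λ x → x :+ con 0ℚ := con 1ℚ :* x) refl (g x)
sumˡ-if g false x = sym (ℚ.*-zeroˡ (g x))

sumˡ-edges : ∀ (G : Graph n) g →
  sumˡ g (edges G) ≡ sum λ i → sum λ j → ⟦ (toℕ i <ᵇ toℕ j) ∧ adj G i j ⟧ * g (i , j)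
sumˡ-edges {n} G g = trans (sumˡ-concatMap g (λ i → concatMap (edge i) (allFin n)) id) (sum-cong λ i →
  trans (sumˡ-concatMap g (edge i) id) (sum-cong λ j →
    sumˡ-if g ((toℕ i <ᵇ toℕ j) ∧ adj G i j) (i , j)))
  where
  edge : Fin n → Fin n → List (Edge n)
  edge i j = if (toℕ i <ᵇ toℕ j) ∧ adj G i j then (i , j) ∷ [] else []

⟦⟧-² : ∀ b → ⟦ b ⟧ ² ≡ ⟦ b ⟧
⟦⟧-² true  = refl
⟦⟧-² false = refl

0≤⟦⟧ : ∀ b → 0ℚ ≤ℚ ⟦ b ⟧
0≤⟦⟧ true  = 0≤1
0≤⟦⟧ false = ℚ.≤-refl

⟦⟧≤1 : ∀ b → ⟦ b ⟧ ≤ℚ 1ℚ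
⟦⟧≤1 true  = ℚ.≤-refl
⟦⟧≤1 false = 0≤1

length-filter : ∀ (f : A → Bool) (h : Fin n → A) →
  ℕ→ℚ (length (filter (λ j → f j Bool.≟ true) (tabulate h))) ≡ sum (λ j → ⟦ f (h j) ⟧)
length-filter {n = zero}  f h = refl
length-filter {n = suc n} f h with f (h zero)
... | true  = trans (ℕ→ℚ-suc (length (filter (λ j → f j Bool.≟ true) (tabulate (h ∘ suc))))) (cong (1ℚ +_) (length-filter f (h ∘ suc)))
... | false = trans (length-filter f (h ∘ suc)) (sym (ℚ.+-identityˡ (sum (λ j → ⟦ f (h (suc j)) ⟧))))

degree-sum : ∀ {G : Graph n} {d} → IsRegular G d → ∀ v → sum (λ w → ⟦ adj G v w ⟧) ≡ ℕ→ℚ d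
degree-sum {G = G} reg v = trans (sym (length-filter (adj G v) id)) (cong ℕ→ℚ (reg v))

-- Exactly one of the two orders holds for distinct vertices; for equal ones neither does, and
-- irreflexivity makes the right-hand side zero as well.
ordered-or-reversed : ∀ (G : Graph n) v j →
  ⟦ (toℕ v <ᵇ toℕ j) ∧ adj G v j ⟧ + ⟦ (toℕ j <ᵇ toℕ v) ∧ adj G j v ⟧ ≡ ⟦ adj G v j ⟧
ordered-or-reversed G v j rewrite Graph.sym G j v with adj G v j in eq
... | false rewrite Bool.∧-zeroʳ (toℕ v <ᵇ toℕ j) | Bool.∧-zeroʳ (toℕ j <ᵇ toℕ v) = refl
... | true with toℕ v <ᵇ toℕ j in lt | toℕ j <ᵇ toℕ v in gt
...   | true  | false = refl
...   | false | true  = refl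
...   | true  | true  = ⊥-elim (ℕ.<-asym (ℕ.<ᵇ⇒< (toℕ v) (toℕ j) (subst IsTrue (sym lt) _))
                                         (ℕ.<ᵇ⇒< (toℕ j) (toℕ v) (subst IsTrue (sym gt) _)))
...   | false | false with ℕ.<-cmp (toℕ v) (toℕ j)
...     | tri< v<j _ _ = ⊥-elim (subst IsTrue lt (ℕ.<⇒<ᵇ v<j))
...     | tri> _ _ j<v = ⊥-elim (subst IsTrue gt (ℕ.<⇒<ᵇ j<v))
...     | tri≈ _ v≡j _ 
        with () ← trans (sym eq) (trans (cong (adj G v) (sym (Fin.toℕ-injective v≡j))) (irrefl G v))

-- The two endpoint terms yield one sum over the neighbours above `v` and one over those below it;
-- the symmetry of `h` merges them.
sum-incident-edges : ∀ (G : Graph n) (h : Fin n → Fin n → ℚ) → (∀ i j → h i j ≡ h j i) → ∀ v →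
  sumˡ (λ (i , j) → h i j * (κ v i + κ v j)) (edges G) ≡ sum (λ j → ⟦ adj G v j ⟧ * h v j)
sum-incident-edges {n} G h h-sym v = begin
  sumˡ (λ (i , j) → h i j * (κ v i + κ v j)) (edges G)
    ≡⟨ sumˡ-edges G _ ⟩
  (sum λ i → sum λ j → L i j * (h i j * (κ v i + κ v j)))
    ≡⟨ (sum-cong λ i → trans
         (sum-cong λ j → solve 4 (λ l h a b → l :* (h :* (a :+ b)) := a :* (l :* h) :+ b :* (l :* h)) refl
           (L i j) (h i j) (κ v i) (κ v j))
         (sum-+ (λ j → κ v i * (L i j * h i j)) (λ j → κ v j * (L i j * h i j)))) ⟩
  (sum λ i → (sum λ j → κ v i * (L i j * h i j)) + (sum λ j → κ v j * (L i j * h i j)))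
    ≡⟨ (sum-cong λ i → cong₂ _+_ (sum-* (κ v i) (λ j → L i j * h i j)) (sum-κ v (λ j → L i j * h i j))) ⟩
  (sum λ i → κ v i * (sum λ j → L i j * h i j) + L i v * h i v)
    ≡⟨ sum-+ (λ i → κ v i * (sum λ j → L i j * h i j)) (λ i → L i v * h i v) ⟩
  (sum λ i → κ v i * (sum λ j → L i j * h i j)) + (sum λ i → L i v * h i v)
    ≡⟨ cong (_+ (sum λ i → L i v * h i v)) (sum-κ v (λ i → sum λ j → L i j * h i j)) ⟩
  (sum λ j → L v j * h v j) + (sum λ j → L j v * h j v)
    ≡⟨ sum-+ (λ j → L v j * h v j) (λ j → L j v * h j v) ⟨
  (sum λ j → L v j * h v j + L j v * h j v)
    ≡⟨ (sum-cong λ j → trans (cong (λ x → L v j * h v j + L j v * x) (h-sym j v))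
         (trans (sym (ℚ.*-distribʳ-+ (h v j) (L v j) (L j v)))
                (cong (_* h v j) (ordered-or-reversed G v j)))) ⟩
  (sum λ j → ⟦ adj G v j ⟧ * h v j) ∎
  where
  open ≡-Reasoning
  L : Fin n → Fin n → ℚ
  L i j = ⟦ (toℕ i <ᵇ toℕ j) ∧ adj G i j ⟧

length≡sumˡ : (xs : List A) → ℕ→ℚ (length xs) ≡ sumˡ (λ _ → 1ℚ) xs
length≡sumˡ []       = refl
length≡sumˡ (x ∷ xs) = trans (ℕ→ℚ-suc (length xs)) (cong (1ℚ +_) (length≡sumˡ xs))

length-edges : ∀ {G : Graph n} {d} → IsRegular G d → ℕ→ℚ (length (edges G)) ≤ℚ ℕ→ℚ n * ℕ→ℚ d
length-edges {n} {G} {d} reg = begin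
  ℕ→ℚ (length (edges G))           ≡⟨ length≡sumˡ (edges G) ⟩
  sumˡ (λ _ → 1ℚ) (edges G)        ≡⟨ sumˡ-edges G (λ _ → 1ℚ) ⟩
  (sum λ i → sum λ j → ⟦ (toℕ i <ᵇ toℕ j) ∧ adj G i j ⟧ * 1ℚ)
    ≤⟨ (sum-≤ λ i → sum-≤ λ j → ∧-≤ (toℕ i <ᵇ toℕ j) (adj G i j)) ⟩
  (sum λ i → sum λ j → ⟦ adj G i j ⟧) ≡⟨ sum-cong (degree-sum {G = G} reg) ⟩
  (sum {n} λ i → ℕ→ℚ d)            ≡⟨ sum-const n (ℕ→ℚ d) ⟩
  ℕ→ℚ n * ℕ→ℚ d                    ∎
  where
  open ℚ.≤-Reasoning
  ∧-≤ : ∀ a b → ⟦ a ∧ b ⟧ * 1ℚ ≤ℚ ⟦ b ⟧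
  ∧-≤ true  b = ℚ.≤-reflexive (ℚ.*-identityʳ ⟦ b ⟧)
  ∧-≤ false b = 0≤⟦⟧ b

-- Balanced two-colourings

¼ : ℚ
¼ = ½ * ½

-- Method of conditional expectations for a uniformly random c.
balanced-choice : ∀ {m n} (a : Fin m → Fin n → ℚ) (z : Fin m → ℚ) → Σ (Fin n → Bool) λ c →
  sum (λ v → (sum (λ w → ⟦ c w ⟧ * a v w) - z v) ²)
    ≤ℚ sum (λ v → ¼ * sum (λ w → a v w ²) + (½ * sum (a v) - z v) ²)
balanced-choice {n = zero} a z = (λ ()) , ℚ.≤-reflexive (sum-cong λ v →
  solve 1 (λ z → (con 0ℚ :- z) :* (con 0ℚ :- z) := con ¼ :* con 0ℚ :+ (con ½ :* con 0ℚ :- z) :* (con ½ :* con 0ℚ :- z))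
    refl (z v))
balanced-choice {m} {suc n} a z = choose (ℚ.≤-total (R z₀) (R z₁))
  where
  a′ : Fin m → Fin n → ℚ
  a′ v w = a v (suc w)
  z₀ z₁ : Fin m → ℚ
  z₀ = z
  -- Setting `c zero` to true moves the contribution of this coordinate into the target value.
  z₁ v = z v - a v zero
  r : (Fin m → ℚ) → Fin m → ℚ
  r y v = ¼ * sum (λ w → a′ v w ²) + (½ * sum (a′ v) - y v) ²
  R : (Fin m → ℚ) → ℚ
  R y = sum (r y)
  target : ℚ
  target = sum (λ v → ¼ * sum (λ w → a v w ²) + (½ * sum (a v) - z v) ²)

  -- A fair coin of weight a has variance a² / 4, so `target` is exactly the mean of the bounds for
  -- the two choices, and the smaller of these does not exceed it.
  average : target ≡ ½ * R z₀ + ½ * R z₁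
  average = begin
    target
      ≡⟨ (sum-cong λ v → solve 4 (λ a s t z →
           con ¼ :* (a :* a :+ t) :+ (con ½ :* (a :+ s) :- z) :* (con ½ :* (a :+ s) :- z)
        := con ½ :* (con ¼ :* t :+ (con ½ :* s :- z) :* (con ½ :* s :- z))
        :+ con ½ :* (con ¼ :* t :+ (con ½ :* s :- (z :- a)) :* (con ½ :* s :- (z :- a)))) refl
        (a v zero) (sum (a′ v)) (sum (λ w → a′ v w ²)) (z v)) ⟩
    sum (λ v → ½ * r z₀ v + ½ * r z₁ v)
      ≡⟨ sum-+ (λ v → ½ * r z₀ v) (λ v → ½ * r z₁ v) ⟩
    sum (λ v → ½ * r z₀ v) + sum (λ v → ½ * r z₁ v)
      ≡⟨ cong₂ _+_ (sum-* ½ (r z₀)) (sum-* ½ (r z₁)) ⟩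
    ½ * R z₀ + ½ * R z₁ ∎
    where open ≡-Reasoning

  0≤½ : 0ℚ ≤ℚ ½
  0≤½ = ℚ.nonNegative⁻¹ ½

  extend : ∀ b (y : Fin m → ℚ) → (∀ v → y v ≡ z v - ⟦ b ⟧ * a v zero) → R y ≤ℚ target → Σ (Fin (suc n) → Bool) λ c →
    sum (λ v → (sum (λ w → ⟦ c w ⟧ * a v w) - z v) ²) ≤ℚ target
  extend b y y≡ R≤ = let (c , h) = balanced-choice a′ y in
    (b VF.∷ c) , ℚ.≤-trans (ℚ.≤-reflexive (sum-cong λ v → cong _² (trans
      (solve 3 (λ x s z → x :+ s :- z := s :- (z :- x)) refl
        (⟦ b ⟧ * a v zero) (sum (λ w → ⟦ c w ⟧ * a′ v w)) (z v))
      (cong (λ x → sum (λ w → ⟦ c w ⟧ * a′ v w) - x) (sym (y≡ v)))))) (ℚ.≤-trans h R≤)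

  choose : R z₀ ≤ℚ R z₁ ⊎ R z₁ ≤ℚ R z₀ → Σ (Fin (suc n) → Bool) λ c →
    sum (λ v → (sum (λ w → ⟦ c w ⟧ * a v w) - z v) ²) ≤ℚ target
  choose (inj₁ le) = extend false z₀ (λ v → solve 2 (λ z a → z := z :- con 0ℚ :* a) refl (z v) (a v zero))
    (≤-by (½ * (R z₁ - R z₀)) (0≤* 0≤½ (0≤y-x le))
      (trans average (solve 2 (λ x y → con ½ :* x :+ con ½ :* y := x :+ con ½ :* (y :- x)) refl (R z₀) (R z₁))))
  choose (inj₂ le) = extend true z₁ (λ v → solve 2 (λ z a → z :- a := z :- con 1ℚ :* a) refl (z v) (a v zero))
    (≤-by (½ * (R z₀ - R z₁)) (0≤* 0≤½ (0≤y-x le))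
      (trans average (solve 2 (λ x y → con ½ :* x :+ con ½ :* y := y :+ con ½ :* (x :- y)) refl (R z₀) (R z₁))))

cutDegree : Graph n → (Fin n → Bool) → Fin n → ℚ
cutDegree G c v = sum λ j → ⟦ adj G v j ⟧ * ⟦ c v xor c j ⟧

-- Under a uniform colouring the number of neighbours coloured true is binomial with mean d / 2 and
-- variance d / 4. Centring at d / 2 removes the bias term of `balanced-choice`.
balanced-colouring : ∀ {G : Graph n} {d} → IsRegular G d → Σ (Fin n → Bool) λ c →
  sum (λ v → (cutDegree G c v - ½ * ℕ→ℚ d) ²) ≤ℚ ℕ→ℚ n * (¼ * ℕ→ℚ d)
balanced-colouring {n} {G} {d} reg =
  let (c , h) = balanced-choice (λ v w → ⟦ adj G v w ⟧) (λ _ → ½ * ℕ→ℚ d)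
  in c , ℚ.≤-trans (ℚ.≤-reflexive (sum-cong λ v → flip-colour c v (c v) refl))
    (ℚ.≤-trans h (ℚ.≤-reflexive (trans (sum-cong λ v → trans
      (cong₂ (λ s t → ¼ * s + (½ * t - ½ * D) ²)
        (trans (sum-cong λ w → ⟦⟧-² (adj G v w)) (degree-sum {G = G} reg v)) (degree-sum {G = G} reg v))
      (solve 1 (λ d → con ¼ :* d :+ (con ½ :* d :- con ½ :* d) :* (con ½ :* d :- con ½ :* d) := con ¼ :* d) refl D))
      (sum-const n (¼ * D)))))
  where
  D : ℚ
  D = ℕ→ℚ d
  -- Whatever the colour of v, its number of neighbours across the cut is as far from d / 2 as the
  -- number of its neighbours coloured true.
  flip-colour : ∀ (c : Fin n → Bool) v b → c v ≡ b →
    (cutDegree G c v - ½ * D) ² ≡ (sum (λ w → ⟦ c w ⟧ * ⟦ adj G v w ⟧) - ½ * D) ²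
  flip-colour c v false eq = cong (λ x → (x - ½ * D) ²) (sum-cong λ w →
    trans (cong (λ b → ⟦ adj G v w ⟧ * ⟦ b xor c w ⟧) eq) (ℚ.*-comm ⟦ adj G v w ⟧ ⟦ c w ⟧))
  flip-colour c v true eq = trans
    -- X - d / 2 is written through X + Y, so that X + Y = d can be substituted; what remains is d /
    -- 2 - Y.
    (solve 3 (λ x y d → (x :- con ½ :* d) :* (x :- con ½ :* d)
       := (((x :+ y) :- d) :+ con ½ :* d :- y) :* (((x :+ y) :- d) :+ con ½ :* d :- y)) refl X Y D)
    (trans (cong (λ s → (s - D + ½ * D - Y) ²) X+Y)
      (solve 2 (λ y d → (d :- d :+ con ½ :* d :- y) :* (d :- d :+ con ½ :* d :- y)
         := (y :- con ½ :* d) :* (y :- con ½ :* d)) refl Y D))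
    where
    X Y : ℚ
    X = cutDegree G c v
    Y = sum (λ w → ⟦ c w ⟧ * ⟦ adj G v w ⟧)
    complement : ∀ a b → a * ⟦ not b ⟧ + ⟦ b ⟧ * a ≡ a
    complement a true  = solve 1 (λ a → a :* con 0ℚ :+ con 1ℚ :* a := a) refl a
    complement a false = solve 1 (λ a → a :* con 1ℚ :+ con 0ℚ :* a := a) refl a
    X+Y : X + Y ≡ D
    X+Y = trans (sym (sum-+ (λ w → ⟦ adj G v w ⟧ * ⟦ c v xor c w ⟧) (λ w → ⟦ c w ⟧ * ⟦ adj G v w ⟧)))
      (trans (sum-cong λ w → trans (cong (λ b → ⟦ adj G v w ⟧ * ⟦ b xor c w ⟧ + ⟦ c w ⟧ * ⟦ adj G v w ⟧) eq)
                                   (complement ⟦ adj G v w ⟧ (c w)))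
             (degree-sum {G = G} reg v))

-- The bichromatic subgraph

κ-sym : ∀ (v i : Fin n) → κ v i ≡ κ i v
κ-sym zero    zero    = refl
κ-sym zero    (suc i) = refl
κ-sym (suc v) zero    = refl
κ-sym (suc v) (suc i) = κ-sym v i

-- Summed over `F`, this is the degree of `v` in the bichromatic part of `F`.
incidence : (Fin n → Bool) → Fin n → Edge n → ℚ
incidence c v (i , j) = ⟦ c i xor c j ⟧ * (κ v i + κ v j)

deviation : (Fin n → Bool) → ℚ → List (Edge n) → Fin n → ℚ
deviation c μ F v = (sumˡ (incidence c v) F - μ) ²

-- The values are 0 and 1 only: 2 would require a loop at `v`, and a loop is never bichromatic.
incidence-² : ∀ (c : Fin n → Bool) v e → incidence c v e ² ≡ incidence c v e
incidence-² c v (i , j) with v Fin.≟ i | v Fin.≟ j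
... | no _     | no _     = idem (c i xor c j) false
  where
  idem : ∀ b b′ → (⟦ b ⟧ * (0ℚ + ⟦ b′ ⟧)) ² ≡ ⟦ b ⟧ * (0ℚ + ⟦ b′ ⟧)
  idem true  true  = refl
  idem true  false = refl
  idem false true  = refl
  idem false false = refl
... | no _     | yes _    = idem (c i xor c j)
  where
  idem : ∀ b → (⟦ b ⟧ * (0ℚ + 1ℚ)) ² ≡ ⟦ b ⟧ * (0ℚ + 1ℚ)
  idem true  = refl
  idem false = refl
... | yes _    | no _     = idem (c i xor c j)
  where
  idem : ∀ b → (⟦ b ⟧ * (1ℚ + 0ℚ)) ² ≡ ⟦ b ⟧ * (1ℚ + 0ℚ)
  idem true  = refl
  idem false = refl
... | yes refl | yes refl rewrite Bool.xor-same (c v) = refl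

sumˡ-cong : ∀ {f g : A → ℚ} → (∀ x → f x ≡ g x) → ∀ xs → sumˡ f xs ≡ sumˡ g xs
sumˡ-cong f≡g []       = refl
sumˡ-cong f≡g (x ∷ xs) = cong₂ _+_ (f≡g x) (sumˡ-cong f≡g xs)

ℕ→ℚ-count : (W : Fin n → Bool) → ℕ→ℚ (count W) ≡ sum (λ v → ⟦ W v ⟧)
ℕ→ℚ-count {zero}  W = refl
ℕ→ℚ-count {suc n} W = trans (ℕ→ℚ-+ (bit (W zero)) (count (W ∘ suc)))
  (cong₂ _+_ (ℕ→ℚ-bit (W zero)) (ℕ→ℚ-count (W ∘ suc)))
  where
  ℕ→ℚ-bit : ∀ b → ℕ→ℚ (bit b) ≡ ⟦ b ⟧
  ℕ→ℚ-bit true  = refl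
  ℕ→ℚ-bit false = refl

2ℚ 4ℚ : ℚ
2ℚ = ℕ→ℚ 2
4ℚ = ℕ→ℚ 4

-- +1 on the set and -1 off it.
sign : Bool → ℚ
sign b = 2ℚ * ⟦ b ⟧ - 1ℚ

module _ (c : Fin n → Bool) where

  sum-sign-incidence : ∀ (W : Fin n → Bool) a b →
    sum (λ v → sign (W v) * incidence c v (a , b)) ≡ ⟦ c a xor c b ⟧ * (sign (W a) + sign (W b))
  sum-sign-incidence W a b = begin
    sum (λ v → sign (W v) * (h * (κ v a + κ v b)))
      ≡⟨ (sum-cong λ v → trans
           (cong₂ (λ x y → sign (W v) * (h * (x + y))) (κ-sym v a) (κ-sym v b))
           (solve 4 (λ s h x y → s :* (h :* (x :+ y)) := x :* (h :* s) :+ y :* (h :* s)) refl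
             (sign (W v)) h (κ a v) (κ b v))) ⟩
    sum (λ v → κ a v * (h * sign (W v)) + κ b v * (h * sign (W v)))
      ≡⟨ sum-+ (λ v → κ a v * (h * sign (W v))) (λ v → κ b v * (h * sign (W v))) ⟩
    sum (λ v → κ a v * (h * sign (W v))) + sum (λ v → κ b v * (h * sign (W v)))
      ≡⟨ cong₂ _+_ (sum-κ a (λ v → h * sign (W v))) (sum-κ b (λ v → h * sign (W v))) ⟩
    h * sign (W a) + h * sign (W b)
      ≡⟨ ℚ.*-distribˡ-+ h (sign (W a)) (sign (W b)) ⟨
    h * (sign (W a) + sign (W b)) ∎
    where
    open ≡-Reasoning
    h : ℚ
    h = ⟦ c a xor c b ⟧

  -- Monochromatic edges have incidence zero everywhere, so the cover may ignore them.
  CoversCut : (Fin n → Bool) → List (Edge n) → Set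
  CoversCut W F = ∀ {e} → e ∈ F → Bichromatic c e → Covered W e

  -- Every edge has at least as many endpoints in W as outside W.
  sum-sign-degree : ∀ (W : Fin n → Bool) F → CoversCut W F →
    0ℚ ≤ℚ sum (λ v → sign (W v) * sumˡ (incidence c v) F)
  sum-sign-degree W [] cov = ℚ.≤-reflexive (sym (trans
    (sum-cong λ v → trans (ℚ.*-zeroʳ (sign (W v))) (sym (ℚ.*-zeroʳ 0ℚ)))
    (trans (sum-* 0ℚ (λ (v : Fin n) → 0ℚ)) (ℚ.*-zeroˡ (sum {n} (λ v → 0ℚ))))))
  sum-sign-degree W ((a , b) ∷ F) cov = subst (0ℚ ≤ℚ_)
    (sym (trans
      (sum-cong λ v → ℚ.*-distribˡ-+ (sign (W v)) (incidence c v (a , b)) (sumˡ (incidence c v) F))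
      (trans (sum-+ (λ v → sign (W v) * incidence c v (a , b)) (λ v → sign (W v) * sumˡ (incidence c v) F))
        (cong (_+ sum (λ v → sign (W v) * sumˡ (incidence c v) F)) (sum-sign-incidence W a b)))))
    (0≤+ (edge (c a xor c b) (cov (here refl))) (sum-sign-degree W F (cov ∘ there)))
    where
    -1≤sign : ∀ x → - 1ℚ ≤ℚ sign x
    -1≤sign true  = ℚ.≤-trans (ℚ.nonPositive⁻¹ (- 1ℚ)) 0≤1
    -1≤sign false = ℚ.≤-refl
    edge : ∀ h → (h ≡ true → Covered W (a , b)) → 0ℚ ≤ℚ ⟦ h ⟧ * (sign (W a) + sign (W b))
    edge false _ = ℚ.≤-reflexive (sym (ℚ.*-zeroˡ (sign (W a) + sign (W b))))
    edge true  k = 0≤* 0≤1 (ends (k refl))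
      where
      ends : Covered W (a , b) → 0ℚ ≤ℚ sign (W a) + sign (W b)
      ends (v , inj₁ refl , h) rewrite h = ℚ.+-monoʳ-≤ 1ℚ (-1≤sign (W b))
      ends (v , inj₂ refl , h) rewrite h = ℚ.+-monoˡ-≤ 1ℚ (-1≤sign (W a))

  -- 2 s σ y ≤ y² + s² for σ = ± 1
  cover-bound : ∀ {s} μ (W : Fin n → Bool) F → 0ℚ ≤ℚ s → CoversCut W F →
    2ℚ * s * μ * ℕ→ℚ n ≤ℚ
      4ℚ * s * μ * ℕ→ℚ (count W) + (sum (deviation c μ F) + ℕ→ℚ n * s ²)
  cover-bound {s} μ W F 0≤s cov = ≤-by (2ℚ * s * S + sum R) (0≤+ (0≤* (0≤* 0≤2 0≤s) (sum-sign-degree W F cov))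
    (ℚ.≤-trans (ℚ.≤-reflexive (sym (trans (sum-const n 0ℚ) (ℚ.*-zeroʳ (ℕ→ℚ n))))) (sum-≤ λ v → 0≤² (x v - μ - s * sign (W v)))))
    (trans (cong₂ (λ a b → 4ℚ * s * μ * a + (Q + b)) (ℕ→ℚ-count W) (sym (sum-const n (s ²))))
      (trans expand (cong (_+ (2ℚ * s * S + sum R))
        (trans (sum-const n (2ℚ * s * μ)) (ℚ.*-comm (ℕ→ℚ n) (2ℚ * s * μ))))))
    where
    x : Fin n → ℚ
    x v = sumˡ (incidence c v) F
    S Q : ℚ
    S = sum (λ v → sign (W v) * x v)
    Q = sum (deviation c μ F)
    R : Fin n → ℚ
    R v = (x v - μ - s * sign (W v)) ²
    0≤2 : 0ℚ ≤ℚ 2ℚ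
    0≤2 = 0≤ℕ→ℚ 2
    -- Expand the square with σ² = 1 for σ = `sign b`; since 2 `⟦ b ⟧` = σ + 1, the terms containing
    -- σ μ cancel.
    pointwise : ∀ b y → 4ℚ * s * μ * ⟦ b ⟧ + ((y - μ) ² + s ²) ≡
      2ℚ * s * μ + (2ℚ * s * (sign b * y) + (y - μ - s * sign b) ²)
    pointwise true y = solve 3 (λ s μ y →
        con 4ℚ :* s :* μ :* con 1ℚ :+ ((y :- μ) :* (y :- μ) :+ s :* s)
      := con 2ℚ :* s :* μ :+ (con 2ℚ :* s :* (con 1ℚ :* y) :+ (y :- μ :- s :* con 1ℚ) :* (y :- μ :- s :* con 1ℚ))) refl s μ y
    pointwise false y = solve 3 (λ s μ y →
        con 4ℚ :* s :* μ :* con 0ℚ :+ ((y :- μ) :* (y :- μ) :+ s :* s)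
      := con 2ℚ :* s :* μ :+ (con 2ℚ :* s :* (con (- 1ℚ) :* y) :+ (y :- μ :- s :* con (- 1ℚ)) :* (y :- μ :- s :* con (- 1ℚ)))) refl s μ y
    expand : 4ℚ * s * μ * sum (λ v → ⟦ W v ⟧) + (Q + sum (λ (v : Fin n) → s ²)) ≡
      sum (λ (v : Fin n) → 2ℚ * s * μ) + (2ℚ * s * S + sum R)
    expand = begin
      4ℚ * s * μ * sum (λ v → ⟦ W v ⟧) + (Q + sum (λ (v : Fin n) → s ²))
        ≡⟨ cong₂ _+_ (sym (sum-* (4ℚ * s * μ) (λ v → ⟦ W v ⟧))) (sym (sum-+ (deviation c μ F) (λ v → s ²))) ⟩
      sum (λ v → 4ℚ * s * μ * ⟦ W v ⟧) + sum (λ v → deviation c μ F v + s ²)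
        ≡⟨ sym (sum-+ (λ v → 4ℚ * s * μ * ⟦ W v ⟧) (λ v → deviation c μ F v + s ²)) ⟩
      sum (λ v → 4ℚ * s * μ * ⟦ W v ⟧ + (deviation c μ F v + s ²))
        ≡⟨ (sum-cong λ v → pointwise (W v) (x v)) ⟩
      sum (λ v → 2ℚ * s * μ + (2ℚ * s * (sign (W v) * x v) + R v))
        ≡⟨ sum-+ (λ v → 2ℚ * s * μ) (λ v → 2ℚ * s * (sign (W v) * x v) + R v) ⟩
      sum (λ (v : Fin n) → 2ℚ * s * μ) + sum (λ v → 2ℚ * s * (sign (W v) * x v) + R v)
        ≡⟨ cong (sum (λ (v : Fin n) → 2ℚ * s * μ) +_) (trans (sum-+ (λ v → 2ℚ * s * (sign (W v) * x v)) R)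
             (cong (_+ sum R) (sum-* (2ℚ * s) (λ v → sign (W v) * x v)))) ⟩
      sum (λ (v : Fin n) → 2ℚ * s * μ) + (2ℚ * s * S + sum R) ∎
      where open ≡-Reasoning

  -- The bichromatic edges of `F` form a bipartite graph, and a matching among them is a matching of
  -- `F`. Comparison of rationals is decidable, so the double negation left by `kőnig` can be
  -- discharged here.
  ν-bound : ∀ {s μ} F → 0ℚ ≤ℚ s → 0ℚ ≤ℚ μ →
    2ℚ * s * μ * ℕ→ℚ n ≤ℚ 4ℚ * s * μ * ℕ→ℚ (ν F) + (sum (deviation c μ F) + ℕ→ℚ n * s ²)
  ν-bound {s} {μ} F 0≤s 0≤μ = decidable-stable (_ ℚ.≤? _) λ ¬goal →
    kőnig {c = c} (length cut) cut ℕ.≤-refl (λ m → proj₂ (∈-filter⁻ bichromatic? {xs = F} m)) λ (W , cov , size) →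
    ¬goal (ℚ.≤-trans
      (cover-bound μ W F 0≤s (λ m bi → cov (∈-filter⁺ bichromatic? m bi)))
      (ℚ.+-monoˡ-≤ (sum (deviation c μ F) + ℕ→ℚ n * s ²)
        (*-monoʳ (4ℚ * s * μ) (0≤* (0≤* (0≤ℕ→ℚ 4) 0≤s) 0≤μ)
          (ℕ→ℚ-mono (ℕ.≤-trans size (ν-⊆ (filter-⊆ bichromatic? F)))))))
    where
    bichromatic? : ∀ e → Dec (Bichromatic c e)
    bichromatic? (a , b) = (c a xor c b) Bool.≟ true
    cut : List (Edge n)
    cut = filter bichromatic? F

E-sum : ∀ p (f : Fin n → List A → ℚ) es acc →
  E p (λ F → sum (λ v → f v F)) es acc ≡ sum (λ v → E p (f v) es acc)
E-sum {zero}  p f es acc = E-const p 0ℚ es acc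
E-sum {suc n} p f es acc = trans (E-+ p (f zero) (λ F → sum (λ v → f (suc v) F)) es acc)
  (cong (E p (f zero) es acc +_) (E-sum p (f ∘ suc) es acc))

5/4 : ℚ
5/4 = ℕ→ℚ 5 * ¼

-- The factor 5/4 has two sources: sampling contributes at most p d per vertex, and the imbalance of
-- the colouring contributes p² d / 4 ≤ p d / 4 on average.
expected-deviation : ∀ {G : Graph n} {d p} → IsRegular G d → 0ℚ ≤ℚ p → p ≤ℚ 1ℚ → Σ (Fin n → Bool) λ c →
  E p (λ F → sum (deviation c (½ * (p * ℕ→ℚ d)) F)) (edges G) [] ≤ℚ ℕ→ℚ n * (5/4 * (p * ℕ→ℚ d))
expected-deviation {n} {G} {d} {p} reg 0≤p p≤1 = c , (begin
  E p (λ F → sum (deviation c (½ * (p * D)) F)) (edges G) []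
    ≡⟨ E-sum p (λ v F → deviation c (½ * (p * D)) F v) (edges G) [] ⟩
  sum (λ v → E p (λ F → deviation c (½ * (p * D)) F v) (edges G) [])
    ≡⟨ sum-cong second-moment ⟩
  sum (λ v → p * (1ℚ - p) * k v + p * p * (k v - ½ * D) ²)
    ≤⟨ sum-≤ bound ⟩
  sum (λ v → p * D + p * p * (k v - ½ * D) ²)
    ≡⟨ sum-+ (λ v → p * D) (λ v → p * p * (k v - ½ * D) ²) ⟩
  sum {n} (λ v → p * D) + sum (λ v → p * p * (k v - ½ * D) ²)
    ≡⟨ cong₂ _+_ (sum-const n (p * D)) (sum-* (p * p) (λ v → (k v - ½ * D) ²)) ⟩
  N * (p * D) + p * p * sum (λ v → (k v - ½ * D) ²)
    ≤⟨ ℚ.+-monoʳ-≤ (N * (p * D)) (*-monoʳ (p * p) (0≤* 0≤p 0≤p) balanced) ⟩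
  N * (p * D) + p * p * (N * (¼ * D))
    ≤⟨ ≤-by ((1ℚ - p) * (p * (N * (¼ * D)))) (0≤* (0≤y-x p≤1) (0≤* 0≤p (0≤* (0≤ℕ→ℚ n) (0≤* (ℚ.nonNegative⁻¹ ¼) (0≤ℕ→ℚ d)))))
        (solve 3 (λ n p d → n :* (con 5/4 :* (p :* d))
           := n :* (p :* d) :+ p :* p :* (n :* (con ¼ :* d)) :+ (con 1ℚ :- p) :* (p :* (n :* (con ¼ :* d)))) refl N p D) ⟩
  N * (5/4 * (p * D)) ∎)
  where
  open ℚ.≤-Reasoning
  N D : ℚ
  N = ℕ→ℚ n
  D = ℕ→ℚ d
  c : Fin n → Bool
  c = proj₁ (balanced-colouring {G = G} reg)
  k : Fin n → ℚ
  k = cutDegree G c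
  balanced : sum (λ v → (k v - ½ * D) ²) ≤ℚ N * (¼ * D)
  balanced = proj₂ (balanced-colouring {G = G} reg)
  xor-comm : ∀ i j → ⟦ c i xor c j ⟧ ≡ ⟦ c j xor c i ⟧
  xor-comm i j = cong ⟦_⟧ (Bool.xor-comm (c i) (c j))
  degree-in-cut : ∀ v → sumˡ (incidence c v) (edges G) ≡ k v
  degree-in-cut v = sum-incident-edges G (λ i j → ⟦ c i xor c j ⟧) xor-comm v
  second-moment : ∀ v → E p (λ F → deviation c (½ * (p * D)) F v) (edges G) []
    ≡ p * (1ℚ - p) * k v + p * p * (k v - ½ * D) ²
  second-moment v = trans (E-additive-² p (incidence c v) (½ * (p * D)) (edges G) [])
    (trans (cong₂ (λ s t → p * (1ℚ - p) * s + (0ℚ + p * t - ½ * (p * D)) ²)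
        (trans (sumˡ-cong (incidence-² c v) (edges G)) (degree-in-cut v)) (degree-in-cut v))
      (solve 3 (λ p k d →
          p :* (con 1ℚ :- p) :* k :+ (con 0ℚ :+ p :* k :- con ½ :* (p :* d)) :* (con 0ℚ :+ p :* k :- con ½ :* (p :* d))
       := p :* (con 1ℚ :- p) :* k :+ p :* p :* ((k :- con ½ :* d) :* (k :- con ½ :* d))) refl p (k v) D))
  0≤k : ∀ v → 0ℚ ≤ℚ k v
  0≤k v = ℚ.≤-trans (ℚ.≤-reflexive (sym (trans (sum-const n 0ℚ) (ℚ.*-zeroʳ N))))
    (sum-≤ λ j → 0≤* (0≤⟦⟧ (adj G v j)) (0≤⟦⟧ (c v xor c j)))
  k≤D : ∀ v → k v ≤ℚ D
  k≤D v = ℚ.≤-trans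
    (sum-≤ λ j → subst (⟦ adj G v j ⟧ * ⟦ c v xor c j ⟧ ≤ℚ_) (ℚ.*-identityʳ ⟦ adj G v j ⟧)
      (*-monoʳ ⟦ adj G v j ⟧ (0≤⟦⟧ (adj G v j)) (⟦⟧≤1 (c v xor c j))))
    (ℚ.≤-reflexive (degree-sum {G = G} reg v))
  bound : ∀ v → p * (1ℚ - p) * k v + p * p * (k v - ½ * D) ² ≤ℚ p * D + p * p * (k v - ½ * D) ²
  bound v = ≤-by (p * (D - k v) + p * p * k v)
    (0≤+ (0≤* 0≤p (0≤y-x (k≤D v))) (0≤* (0≤* 0≤p 0≤p) (0≤k v)))
    (solve 4 (λ p k d r → p :* d :+ r := p :* (con 1ℚ :- p) :* k :+ r :+ (p :* (d :- k) :+ p :* p :* k)) refl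
      p (k v) D (p * p * (k v - ½ * D) ²))

-- Concentration of the matching number

any⁺ : ∀ (q : A → Bool) {x xs} → x ∈ xs → q x ≡ true → any q xs ≡ true
any⁺ q {x} (here refl) h rewrite h = refl
any⁺ q {x} {y ∷ xs} (there m) h = trans (cong (q y ∨_) (any⁺ q m h)) (Bool.∨-zeroʳ (q y))

any⁻ : ∀ (q : A → Bool) xs → any q xs ≡ true → ∃[ x ] (x ∈ xs × q x ≡ true)
any⁻ q (x ∷ xs) h with q x in eq
... | true  = x , here refl , eq
... | false = let (y , m , h′) = any⁻ q xs h in y , there m , h′

≤ᵇ-true : ∀ {x y} → x ≤ℚ y → (x ℚ.≤ᵇ y) ≡ true
≤ᵇ-true {x} {y} le with x ℚ.≤ᵇ y in eq
... | true  = refl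
... | false = ⊥-elim (subst IsTrue eq (ℚ.≤⇒≤ᵇ le))

opaque
  large : ℚ → List (Edge n) → Bool
  large = hasLargeMatching

  hasLargeMatching≡large : ∀ ε (F : List (Edge n)) → hasLargeMatching ε F ≡ large ε F
  hasLargeMatching≡large ε F = refl

  large⁺ : ∀ ε (F : List (Edge n)) → (1ℚ - ε) * ℕ→ℚ n ≤ℚ ℕ→ℚ (2 ℕ.* ν F) → large ε F ≡ true
  large⁺ {n} ε F le = let (M , h , s , l) = ν-attained F in
    any⁺ (λ M → isMatching M ∧ ((1ℚ - ε) * ℕ→ℚ n ℚ.≤ᵇ ℕ→ℚ (2 ℕ.* length M))) (∈-sublists⁺ s)
      (cong₂ _∧_ h (≤ᵇ-true (subst (λ k → (1ℚ - ε) * ℕ→ℚ n ≤ℚ ℕ→ℚ (2 ℕ.* k)) (sym l) le)))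

  large⁻ : ∀ ε (F : List (Edge n)) → large ε F ≡ true → (1ℚ - ε) * ℕ→ℚ n ≤ℚ ℕ→ℚ (2 ℕ.* ν F)
  large⁻ {n} ε F h =
    let (M , M∈ , h′) = any⁻ (λ M → isMatching M ∧ ((1ℚ - ε) * ℕ→ℚ n ℚ.≤ᵇ ℕ→ℚ (2 ℕ.* length M))) (sublists F) h
        (matching , le) = ∧-true {isMatching M} h′
    in ℚ.≤-trans (ℚ.≤ᵇ⇒≤ (subst IsTrue (sym le) _))
         (ℕ→ℚ-mono (ℕ.*-monoʳ-≤ 2 (length≤ν {M = M} {F} matching (∈-sublists⁻ M F M∈))))

large-mono : ∀ {n} ε → InsertionMonotone (λ (F : List (Edge n)) → ⟦ large ε F ⟧)
large-mono ε xs e ys with large ε (xs ++ ys) in eq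
... | false = 0≤⟦⟧ (large ε (xs ++ e ∷ ys))
... | true  = ℚ.≤-reflexive (cong ⟦_⟧ (sym (large⁺ ε (xs ++ e ∷ ys)
  (ℚ.≤-trans (large⁻ ε (xs ++ ys) eq)
    (ℕ→ℚ-mono (ℕ.*-monoʳ-≤ 2 (ν-⊆ (Remove⇒⊆ (Remove-++ xs e ys)))))))))

probLargeMatching≡E : ∀ (G : Graph n) p ε →
  probLargeMatching G p ε ≡ E p (λ F → ⟦ large ε F ⟧) (edges G) []
probLargeMatching≡E G p ε = trans (probAux≡E p (hasLargeMatching ε) (edges G) [])
  (E-cong p (λ F → cong ⟦_⟧ (hasLargeMatching≡large ε F)) (edges G) [])

ν-mono : ∀ {n} → InsertionMonotone (λ (F : List (Edge n)) → ℕ→ℚ (ν F))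
ν-mono xs e ys = ℕ→ℚ-mono (ν-⊆ (Remove⇒⊆ (Remove-++ xs e ys)))

ν-Lipschitz : ∀ {n} → InsertionLipschitz (λ (F : List (Edge n)) → ℕ→ℚ (ν F))
ν-Lipschitz xs e ys = ℚ.≤-trans (ℕ→ℚ-mono (ν-Remove (Remove-++ xs e ys)))
  (ℚ.≤-reflexive (trans (ℕ→ℚ-suc (ν (xs ++ ys))) (ℚ.+-comm 1ℚ (ℕ→ℚ (ν (xs ++ ys))))))

archimedean : ∀ ε → 0ℚ <ℚ ε → ∃[ K ] (0 < K × 1ℚ ≤ℚ ℕ→ℚ K * ε)
-- The witness is the denominator of `ε`, since a positive numerator is at least 1.
archimedean ε@(ℚ.mkℚ (ℤ.+ suc a) d-1 _) _ = suc d-1 , s≤s z≤n , ℚ.toℚᵘ-cancel-≤ (begin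
  ℚᵘ.1ℚᵘ                                    ≤⟨ ℚᵘ.*≤* (ℤ.+≤+ le) ⟩
  ((ℤ.+ suc d-1) ℚᵘ./ 1) ℚᵘ.* toℚᵘ ε        ≃⟨ ℚᵘ.*-congʳ (ℚᵘ.≃-sym (ℚ.toℚᵘ-fromℚᵘ ((ℤ.+ suc d-1) ℚᵘ./ 1))) ⟩
  toℚᵘ (ℕ→ℚ (suc d-1)) ℚᵘ.* toℚᵘ ε          ≃⟨ ℚᵘ.≃-sym (ℚ.toℚᵘ-homo-* (ℕ→ℚ (suc d-1)) ε) ⟩
  toℚᵘ (ℕ→ℚ (suc d-1) * ε)                  ∎)
  where
  open ℚᵘ.≤-Reasoning
  le : 1 ℕ.* (1 ℕ.* suc d-1) ≤ (suc d-1 ℕ.* suc a) ℕ.* 1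
  le = subst₂ _≤_ (sym (trans (ℕ.*-identityˡ (1 ℕ.* suc d-1)) (ℕ.*-identityˡ (suc d-1))))
    (sym (ℕ.*-identityʳ (suc d-1 ℕ.* suc a))) (ℕ.m≤m*n (suc d-1) (suc a))
archimedean (ℚ.mkℚ (ℤ.+ zero) _ _) (ℚ.*<* (ℤ.+<+ ()))
archimedean (ℚ.mkℚ ℤ.-[1+ _ ] _ _) (ℚ.*<* ())

-- This and the next lemma are the two cases of the pointwise inequality behind Chebyshev. Here `t`
-- stands for K², there for K.
deviation-when-large : ∀ t n v m → 0ℚ ≤ℚ t → n ² ≤ℚ ℕ→ℚ 16 * t * (v - m) ² + n ² * 1ℚ
deviation-when-large t n v m 0≤t = ≤-by (ℕ→ℚ 16 * t * (v - m) ²)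
  (0≤* (0≤* (0≤ℕ→ℚ 16) 0≤t) (0≤² (v - m)))
  (solve 2 (λ a n → a :+ n :* con 1ℚ := n :+ a) refl (ℕ→ℚ 16 * t * (v - m) ²) (n ²))

-- The mean satisfies 2 m ≥ n - n / (2 t), while 2 v ≤ n - ε n ≤ n - n / t. Subtracting gives 4 t (m
-- - v) ≥ n, which is then squared.
deviation-when-small : ∀ ε t n v m → 0ℚ ≤ℚ t → 0ℚ ≤ℚ n → 1ℚ ≤ℚ t * ε →
  2ℚ * t * n ≤ℚ 4ℚ * t * m + n → 2ℚ * v ≤ℚ (1ℚ - ε) * n →
  n ² ≤ℚ ℕ→ℚ 16 * t ² * (v - m) ² + n ² * 0ℚ
deviation-when-small ε t n v m 0≤t 0≤n 1≤tε mean 2v≤ =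
  -- This is (gap + n)² - n², where gap + n = 4 t (m - v).
  ≤-by (gap * (gap + 2ℚ * n)) (0≤* 0≤gap (0≤+ 0≤gap (0≤* (0≤ℕ→ℚ 2) 0≤n)))
    (solve 4 (λ t v m n →
        con (ℕ→ℚ 16) :* (t :* t) :* ((v :- m) :* (v :- m)) :+ (n :* n) :* con 0ℚ
     := n :* n :+ (con 4ℚ :* t :* (m :- v) :- n) :* ((con 4ℚ :* t :* (m :- v) :- n) :+ con 2ℚ :* n)) refl t v m n)
  where
  gap : ℚ
  gap = 4ℚ * t * (m - v) - n
  0≤gap : 0ℚ ≤ℚ gap
  0≤gap = subst (0ℚ ≤ℚ_)
    (solve 5 (λ t e v m n →
        (con 4ℚ :* t :* m :+ n :- con 2ℚ :* t :* n)
        :+ (con 2ℚ :* t :* ((con 1ℚ :- e) :* n :- con 2ℚ :* v) :+ con 2ℚ :* n :* (t :* e :- con 1ℚ))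
     := con 4ℚ :* t :* (m :- v) :- n) refl t ε v m n)
    (0≤+ (0≤y-x mean) (0≤+
      (0≤* (0≤* (0≤ℕ→ℚ 2) 0≤t) (0≤y-x 2v≤))
      (0≤* (0≤* (0≤ℕ→ℚ 2) 0≤n) (0≤y-x 1≤tε))))

module _ {G : Graph n} {d} (reg : IsRegular G d) {p} (0≤p : 0ℚ ≤ℚ p) (p≤1 : p ≤ℚ 1ℚ)
         {K} (0<K : 0 < K) (pd≡ : p * ℕ→ℚ d ≡ ℕ→ℚ 20 * ℕ→ℚ K ²) where

  private
    N D T m : ℚ
    N = ℕ→ℚ n
    D = ℕ→ℚ d
    T = ℕ→ℚ K
    m = E p (λ F → ℕ→ℚ (ν F)) (edges G) []
    open Expectation 0≤p p≤1
    0≤T : 0ℚ ≤ℚ T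
    0≤T = 0≤ℕ→ℚ K

  -- With s = 5 K, both error terms of ν-bound are 25 K² n in expectation.
  expected-ν : 2ℚ * T * N ≤ℚ 4ℚ * T * m + N
  expected-ν = *-cancel (ℕ→ℚ 50 * T ²) 0<50T² (begin
    ℕ→ℚ 50 * T ² * (2ℚ * T * N)
      ≡⟨ solve 2 (λ t n → con (ℕ→ℚ 50) :* (t :* t) :* (con 2ℚ :* t :* n)
           := con 2ℚ :* (con (ℕ→ℚ 5) :* t) :* (con ½ :* (con (ℕ→ℚ 20) :* (t :* t))) :* n) refl T N ⟩
    2ℚ * s * (½ * (ℕ→ℚ 20 * T ²)) * N
      ≡⟨ cong (λ x → 2ℚ * s * (½ * x) * N) (sym pd≡) ⟩
    2ℚ * s * μ * N
      ≡⟨ sym (E-const p (2ℚ * s * μ * N) (edges G) []) ⟩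
    E p (λ _ → 2ℚ * s * μ * N) (edges G) []
      ≤⟨ E-mono (λ F → ν-bound c F (0≤* (0≤ℕ→ℚ 5) 0≤T) 0≤μ) (edges G) [] ⟩
    E p (λ F → 4ℚ * s * μ * ℕ→ℚ (ν F) + (sum (deviation c μ F) + N * s ²)) (edges G) []
      ≡⟨ trans (E-+ p (λ F → 4ℚ * s * μ * ℕ→ℚ (ν F)) (λ F → sum (deviation c μ F) + N * s ²) (edges G) [])
           (cong₂ _+_ (E-* p (4ℚ * s * μ) (λ F → ℕ→ℚ (ν F)) (edges G) [])
             (trans (E-+ p (λ F → sum (deviation c μ F)) (λ _ → N * s ²) (edges G) [])
               (cong (EQ +_) (E-const p (N * s ²) (edges G) [])))) ⟩
    4ℚ * s * μ * m + (EQ + N * s ²)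
      ≤⟨ ℚ.+-monoʳ-≤ (4ℚ * s * μ * m) (ℚ.+-monoˡ-≤ (N * s ²) (proj₂ small)) ⟩
    4ℚ * s * μ * m + (N * (5/4 * (p * D)) + N * s ²)
      ≡⟨ cong (λ x → 4ℚ * s * (½ * x) * m + (N * (5/4 * x) + N * s ²)) pd≡ ⟩
    4ℚ * s * (½ * (ℕ→ℚ 20 * T ²)) * m + (N * (5/4 * (ℕ→ℚ 20 * T ²)) + N * s ²)
      ≡⟨ solve 3 (λ t n m →
           con 4ℚ :* (con (ℕ→ℚ 5) :* t) :* (con ½ :* (con (ℕ→ℚ 20) :* (t :* t))) :* m
             :+ (n :* (con 5/4 :* (con (ℕ→ℚ 20) :* (t :* t))) :+ n :* ((con (ℕ→ℚ 5) :* t) :* (con (ℕ→ℚ 5) :* t)))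
           := con (ℕ→ℚ 50) :* (t :* t) :* (con 4ℚ :* t :* m :+ n)) refl T N m ⟩
    ℕ→ℚ 50 * T ² * (4ℚ * T * m + N) ∎)
    where
    open ℚ.≤-Reasoning
    s μ EQ : ℚ
    s = ℕ→ℚ 5 * T
    μ = ½ * (p * D)
    small = expected-deviation {G = G} {d} {p} reg 0≤p p≤1
    c : Fin n → Bool
    c = proj₁ small
    EQ = E p (λ F → sum (deviation c μ F)) (edges G) []
    0≤μ : 0ℚ ≤ℚ μ
    0≤μ = 0≤* (ℚ.nonNegative⁻¹ ½) (0≤* 0≤p (0≤ℕ→ℚ d))
    0<50T² : 0ℚ <ℚ ℕ→ℚ 50 * T ²
    0<50T² = subst (0ℚ <ℚ_) (trans (ℕ→ℚ-* 50 (K ℕ.* K)) (cong (ℕ→ℚ 50 *_) (ℕ→ℚ-* K K)))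
      (0<ℕ→ℚ (ℕ.*-mono-≤ {1} {50} (s≤s z≤n) (ℕ.*-mono-≤ 0<K 0<K)))

  -- The usual tail bound multiplied through by n²: failure forces 16 K² (ν - m)² ≥ n², so the
  -- expectation of the left side bounds n² times the failure probability.
  chebyshev : ∀ {ε} → 1ℚ ≤ℚ T * ε →
    N ² ≤ℚ ℕ→ℚ 16 * T ² * (N * D * p) + N ² * E p (λ F → ⟦ large ε F ⟧) (edges G) []
  chebyshev {ε} 1≤Tε = begin
    N ²
      ≡⟨ sym (E-const p (N ²) (edges G) []) ⟩
    E p (λ _ → N ²) (edges G) []
      ≤⟨ E-mono (λ F → pointwise F (large ε F) refl) (edges G) [] ⟩
    E p (λ F → ℕ→ℚ 16 * T ² * (ℕ→ℚ (ν F) - m) ² + N ² * ⟦ large ε F ⟧) (edges G) []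
      ≡⟨ trans (E-+ p (λ F → ℕ→ℚ 16 * T ² * (ℕ→ℚ (ν F) - m) ²) (λ F → N ² * ⟦ large ε F ⟧) (edges G) [])
           (cong₂ _+_ (E-* p (ℕ→ℚ 16 * T ²) (λ F → (ℕ→ℚ (ν F) - m) ²) (edges G) [])
                      (E-* p (N ²) (λ F → ⟦ large ε F ⟧) (edges G) [])) ⟩
    ℕ→ℚ 16 * T ² * E p (λ F → (ℕ→ℚ (ν F) - m) ²) (edges G) [] + N ² * P
      ≤⟨ ℚ.+-monoˡ-≤ (N ² * P) (*-monoʳ (ℕ→ℚ 16 * T ²) (0≤* (0≤ℕ→ℚ 16) (0≤² T)) variance) ⟩
    ℕ→ℚ 16 * T ² * (N * D * p) + N ² * P ∎
    where
    open ℚ.≤-Reasoning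
    P : ℚ
    P = E p (λ F → ⟦ large ε F ⟧) (edges G) []
    variance : E p (λ F → (ℕ→ℚ (ν F) - m) ²) (edges G) [] ≤ℚ N * D * p
    -- Centring at the mean `m` kills the squared remainder of `variance-bound`.
    variance = ℚ.≤-trans (variance-bound ν-mono ν-Lipschitz m (edges G) [])
      (ℚ.≤-trans (ℚ.≤-reflexive (solve 2 (λ x m → x :+ (m :- m) :* (m :- m) := x) refl (ℕ→ℚ (length (edges G)) * p) m))
        (ℚ.*-monoʳ-≤-nonNeg p {{nonNegative 0≤p}} (length-edges {G = G} reg)))
    pointwise : ∀ F b → large ε F ≡ b →
      N ² ≤ℚ ℕ→ℚ 16 * T ² * (ℕ→ℚ (ν F) - m) ² + N ² * ⟦ b ⟧
    pointwise F true  _ = deviation-when-large (T ²) N (ℕ→ℚ (ν F)) m (0≤² T)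
    pointwise F false eq = deviation-when-small ε T N (ℕ→ℚ (ν F)) m 0≤T (0≤ℕ→ℚ n) 1≤Tε expected-ν 2v≤
      where
      cases : (1ℚ - ε) * N ≤ℚ ℕ→ℚ (2 ℕ.* ν F) ⊎ ℕ→ℚ (2 ℕ.* ν F) ≤ℚ (1ℚ - ε) * N →
        2ℚ * ℕ→ℚ (ν F) ≤ℚ (1ℚ - ε) * N
      cases (inj₁ le) = ⊥-elim (Bool.not-¬ (large⁺ ε F le) eq)
      cases (inj₂ le) = subst (_≤ℚ (1ℚ - ε) * N) (ℕ→ℚ-* 2 (ν F)) le
      2v≤ : 2ℚ * ℕ→ℚ (ν F) ≤ℚ (1ℚ - ε) * N
      2v≤ = cases (ℚ.≤-total ((1ℚ - ε) * N) (ℕ→ℚ (2 ℕ.* ν F)))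

theorem1p1 : (ε : ℚ) → 0ℚ <ℚ ε →
    ∃[ C ] (0 < C × ((δ : ℚ) → 0ℚ <ℚ δ → ∃[ N ] ((n : ℕ) → N ≤ n →
    (d : ℕ) → C ≤ d → (G : Graph n) → IsRegular G d →
    (p : ℚ) → p ≤ℚ 1ℚ → ℕ→ℚ C ≤ℚ p * ℕ→ℚ d →
    1ℚ - δ ≤ℚ probLargeMatching G p ε)))
theorem1p1 ε 0<ε with archimedean ε 0<ε
... | K , 0<K , 1≤Kε = C , 0<C , λ η 0<η → threshold η (ℚ.<⇒≤ 0<η) (archimedean η 0<η)
  where
  C : ℕ
  -- The factor 20 makes the deviation term (5/4) C equal to s² = 25 K² for s = 5 K.
  C = 20 ℕ.* (K ℕ.* K)
  0<C : 0 < C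
  0<C = ℕ.*-mono-≤ {1} {20} (s≤s z≤n) (ℕ.*-mono-≤ 0<K 0<K)
  T : ℚ
  T = ℕ→ℚ K
  C≡ : ℕ→ℚ C ≡ ℕ→ℚ 20 * T ²
  C≡ = trans (ℕ→ℚ-* 20 (K ℕ.* K)) (cong (ℕ→ℚ 20 *_) (ℕ→ℚ-* K K))

  threshold : ∀ η → 0ℚ ≤ℚ η → ∃[ L ] (0 < L × 1ℚ ≤ℚ ℕ→ℚ L * η) → ∃[ N ] ((n : ℕ) → N ≤ n →
    (d : ℕ) → C ≤ d → (G : Graph n) → IsRegular G d →
    (p : ℚ) → p ≤ℚ 1ℚ → ℕ→ℚ C ≤ℚ p * ℕ→ℚ d →
    1ℚ - η ≤ℚ probLargeMatching G p ε)
  threshold η 0≤η (L , 0<L , 1≤Lη) = N₀ , λ n N₀≤n d C≤d G reg p p≤1 C≤pd →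
    let instance D-pos = positive (0<ℕ→ℚ (ℕ.≤-trans 0<C C≤d))
                 D-nonZero = ℚ.pos⇒nonZero (ℕ→ℚ d)
        1/D = ℚ.1/ ℕ→ℚ d
        -- The reduced probability has expected degree exactly `C`; the hypothesis on `p` gives q ≤
        -- p.
        q = ℕ→ℚ C * 1/D
        qD≡C = trans (ℚ.*-assoc (ℕ→ℚ C) 1/D (ℕ→ℚ d))
                 (trans (cong (ℕ→ℚ C *_) (ℚ.*-inverseˡ (ℕ→ℚ d))) (ℚ.*-identityʳ (ℕ→ℚ C)))
        q≤p = ℚ.*-cancelʳ-≤-pos (ℕ→ℚ d) (subst (_≤ℚ p * ℕ→ℚ d) (sym qD≡C) C≤pd)
        0≤q = 0≤* (0≤ℕ→ℚ C) (ℚ.<⇒≤ (ℚ.positive⁻¹ 1/D {{ℚ.1/pos⇒pos (ℕ→ℚ d)}}))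
    in ℚ.≤-trans (sparse n N₀≤n G reg 0≤q (ℚ.≤-trans q≤p p≤1) (trans qD≡C C≡))
         (subst (E q _ (edges G) [] ≤ℚ_) (sym (probLargeMatching≡E G p ε))
           (E-mono-p 0≤q q≤p p≤1 (large-mono ε) (edges G) []))
    where
    N₀ : ℕ
    -- The failure probability is at most 16 K² · 20 K² / n = 320 K⁴ / n, hence at most 1 / L ≤ η
    -- from this point on.
    N₀ = 320 ℕ.* (K ℕ.* K ℕ.* (K ℕ.* K)) ℕ.* L
    0<N₀ : 0 < N₀
    0<N₀ = ℕ.*-mono-≤ (ℕ.*-mono-≤ {1} {320} (s≤s z≤n) (ℕ.*-mono-≤ (ℕ.*-mono-≤ 0<K 0<K) (ℕ.*-mono-≤ 0<K 0<K))) 0<L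
    N₀≡ : ℕ→ℚ N₀ ≡ ℕ→ℚ 320 * (T ² * T ²) * ℕ→ℚ L
    N₀≡ = trans (ℕ→ℚ-* (320 ℕ.* (K ℕ.* K ℕ.* (K ℕ.* K))) L) (cong (_* ℕ→ℚ L)
      (trans (ℕ→ℚ-* 320 (K ℕ.* K ℕ.* (K ℕ.* K))) (cong (ℕ→ℚ 320 *_)
        (trans (ℕ→ℚ-* (K ℕ.* K) (K ℕ.* K)) (cong₂ _*_ (ℕ→ℚ-* K K) (ℕ→ℚ-* K K))))))
    sparse : ∀ n → N₀ ≤ n → ∀ (G : Graph n) {d} → IsRegular G d → ∀ {q} → 0ℚ ≤ℚ q → q ≤ℚ 1ℚ →
      q * ℕ→ℚ d ≡ ℕ→ℚ 20 * T ² → 1ℚ - η ≤ℚ E q (λ F → ⟦ large ε F ⟧) (edges G) []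
    sparse n N₀≤n G {d} reg {q} 0≤q q≤1 qd≡ = *-cancel (N ²) 0<N² (≤-by
      -- The first summand is the slack of the concentration bound; the other two add up to η n² -
      -- 320 K⁴ n, split so that n ≥ 320 K⁴ L and L η ≥ 1 each settle one sign.
      ((320T⁴ * N + N ² * P - N ²) + (η * N * (N - 320T⁴ * ℕ→ℚ L) + N * 320T⁴ * (ℕ→ℚ L * η - 1ℚ)))
      (0≤+ (0≤y-x concentration) (0≤+
        (0≤* (0≤* 0≤η (0≤ℕ→ℚ n)) (0≤y-x (subst (_≤ℚ N) N₀≡ (ℕ→ℚ-mono N₀≤n))))
        (0≤* (0≤* (0≤ℕ→ℚ n) (0≤* (0≤ℕ→ℚ 320) (0≤* (0≤² T) (0≤² T)))) (0≤y-x 1≤Lη))))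
      (solve 5 (λ a n p e l → n :* n :* p := n :* n :* (con 1ℚ :- e)
        :+ ((a :* n :+ n :* n :* p :- n :* n) :+ (e :* n :* (n :- a :* l) :+ n :* a :* (l :* e :- con 1ℚ)))) refl
        320T⁴ N P η (ℕ→ℚ L)))
      where
      N P 320T⁴ : ℚ
      N = ℕ→ℚ n
      P = E q (λ F → ⟦ large ε F ⟧) (edges G) []
      320T⁴ = ℕ→ℚ 320 * (T ² * T ²)
      0<N : 0ℚ <ℚ N
      0<N = 0<ℕ→ℚ (ℕ.≤-trans 0<N₀ N₀≤n)
      0<N² : 0ℚ <ℚ N ²
      0<N² = ℚ.positive⁻¹ (N ²) {{ℚ.pos*pos⇒pos N {{positive 0<N}} N {{positive 0<N}}}}
      concentration : N ² ≤ℚ 320T⁴ * N + N ² * P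
      concentration = subst (λ x → N ² ≤ℚ x + N ² * P)
        (trans (solve 4 (λ t n d q → con (ℕ→ℚ 16) :* (t :* t) :* (n :* d :* q) := con (ℕ→ℚ 16) :* (t :* t) :* (n :* (q :* d))) refl T N (ℕ→ℚ d) q)
          (trans (cong (λ x → ℕ→ℚ 16 * T ² * (N * x)) qd≡)
            (solve 2 (λ t n → con (ℕ→ℚ 16) :* (t :* t) :* (n :* (con (ℕ→ℚ 20) :* (t :* t)))
              := con (ℕ→ℚ 320) :* ((t :* t) :* (t :* t)) :* n) refl T N)))
        (chebyshev {G = G} reg 0≤q q≤1 0<K qd≡ 1≤Kε)
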